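{- Let $n,k$ be integers such that $k\geq 2$ and $n\geq 5k+2$, and let $G$ be a tripartite graph with parts $A$, $B$ and $C$ such that $|A|=|B|=|C|=n$. Let $\alpha$, $\beta$ and $\gamma$ denote the edge densities of $G[A,B]$, $G[A,C]$ and $G[B,C]$, respectively. If $\alpha,\beta,\gamma$ is a $(k,n)$-cyclic triple, then $G$ contains $k$ vertex-disjoint triangles.
   Context: For a tripartite graph $G$ and two of its parts $X,Y$, $G[X,Y]$ denotes the bipartite graph consisting of the edges of $G$ between $X$ and $Y$; its edge density is $|E(G[X,Y])|/(|X||Y|)$. For reals $\alpha,\beta,\gamma\in[0,1]$ and integers $n>k\geq 1$, the triple $\alpha,\beta,\gamma$ is called a $(k,n)$-cyclic triple if all six of the following inequalities hold: $$\beta\left(\alpha-\tfrac{k-1}{n}\right)+\gamma>1,\qquad \alpha\left(\beta-\tfrac{k-1}{n}\right)+\gamma>1,$$ $$\gamma\left(\alpha-\tfrac{k-1}{n}\right)+\beta>1,\qquad \alpha\left(\gamma-\tfrac{k-1}{n}\right)+\beta>1,$$ $$\gamma\left(\beta-\tfrac{k-1}{n}\right)+\alpha>1,\qquad \beta\left(\gamma-\tfrac{k-1}{n}\right)+\alpha>1.$$ -}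

module Defs where

open import Data.Fin using (Fin)
open import Data.Integer as ℤ using (1ℤ)
open import Data.List using (List; []; _∷_; allFin; cartesianProduct; filter; length)
open import Data.List.Membership.Propositional using (_∈_)
open import Data.Nat as ℕ using (ℕ; NonZero)
open import Data.Nat.Properties using (m*n≢0)
open import Data.Product using (_×_; _,_; Σ-syntax)
open import Data.Rational using (ℚ; 1ℚ; _/_; _+_; _-_; _*_; _>_)
open import Relation.Binary.Definitions using (Symmetric; Decidable)
open import Relation.Binary.PropositionalEquality using (_≢_)
open import Relation.Nullary using (¬_)

data Part : Set where
  A B C : Part

Vertex : ℕ → Set
Vertex n = Part × Fin n

-- A finite simple graph with three labelled parts of size n;
-- irreflexivity of Adj is the case i = j of `independent`.
record TripartiteGraph (n : ℕ) : Set₁ where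
  field
    Adj         : Vertex n → Vertex n → Set
    adj?        : Decidable Adj
    symmetric   : Symmetric Adj
    independent : ∀ {X i j} → ¬ Adj (X , i) (X , j)

module _ {n : ℕ} (G : TripartiteGraph n) where
  open TripartiteGraph G

  -- For X ≠ Y, each edge of G[X,Y] is listed exactly once, as
  -- (its end in X , its end in Y).
  edgesBetween : Part → Part → List (Fin n × Fin n)
  edgesBetween X Y =
    filter (λ (i , j) → adj? (X , i) (Y , j)) (cartesianProduct (allFin n) (allFin n))

  density : .{{_ : NonZero n}} → Part → Part → ℚ
  density X Y = _/_ (ℤ.+ length (edgesBetween X Y)) (n ℕ.* n) {{m*n≢0 n n}}

  record Triangle : Set where
    field
      x y z : Vertex n
      xy    : Adj x y
      xz    : Adj x z
      yz    : Adj y z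

    vertices : List (Vertex n)
    vertices = x ∷ y ∷ z ∷ []

  VertexDisjoint : Triangle → Triangle → Set
  VertexDisjoint S T = ∀ {v} → ¬ (v ∈ Triangle.vertices S × v ∈ Triangle.vertices T)

  HasDisjointTriangles : ℕ → Set
  HasDisjointTriangles k =
    Σ[ T ∈ (Fin k → Triangle) ] (∀ {i j} → i ≢ j → VertexDisjoint (T i) (T j))

-- Rational α, β, γ suffice, since edge densities are rational. The notion is
-- meant for α, β, γ ∈ [0,1] and n > k ≥ 1, which the six inequalities do not
-- themselves impose.
record CyclicTriple (k n : ℕ) .{{_ : NonZero n}} (α β γ : ℚ) : Set where
  δ : ℚ
  δ = (ℤ.+ k ℤ.- 1ℤ) / n

  field
    βα>1-γ : β * (α - δ) + γ > 1ℚ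
    αβ>1-γ : α * (β - δ) + γ > 1ℚ
    γα>1-β : γ * (α - δ) + β > 1ℚ
    αγ>1-β : α * (γ - δ) + β > 1ℚ
    γβ>1-α : γ * (β - δ) + α > 1ℚ
    βγ>1-α : β * (γ - δ) + α > 1ℚ

{-# OPTIONS --safe #-}

-- Write m = k − 1, let u, v, w be the proportions of missing edges and α, β, γ = 1 − u, 1 − v,
-- 1 − w. If μ is the largest density, the cyclic condition gives αβ − w > (m/n) μ and the
-- analogues for the other two centres: removing vertices costs at most μ/n each, so there is
-- room for m removals before the triangle criterion αβ > w (for all three centres) fails.
--
-- That criterion: if w is the largest of u, v, w, average the degree pairs over A. Some two
-- vertices of A have degree pairs spanning a segment above the average (otherwise summing the
-- cross products over all pairs gives 0 < 0), and without triangles the union of their two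
-- neighbourhood rectangles in B × C contains only non-edges, which makes w too large.
--
-- For k triangles, first set aside vertices R that are robust, i.e. still in a triangle when
-- 2s vertices are forbidden, where s = m − |R|; they are added back greedily. Then each vertex
-- has a set of 2s vertices meeting all its triangles. Given t ≤ s disjoint triangles T i,
-- suppose that t + 1 do not exist. Call T i strong if one of its vertices lies in a triangle
-- avoiding the other T j and any four further vertices. If T i is not strong, then four edges
-- carry all triangles meeting the packing only in T i. Delete these, the edges joining the
-- special vertices of strong triangles to their covers, and the edges between T i and T j
-- unless both are strong. These are about 3s² edges, fewer than the slack s μ n pays for, so a
-- triangle survives; it meets only strong T i, outside their special vertices. Moving those T i
-- away to fresh triangles through their special vertices makes room for it: a contradiction.
--
-- The argument is by refutation; it yields the triangles since their existence is decidable.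
module Submission where

-- Integer inequalities behind the density criterion and the cost of deletions.

module Inequalities where

  open import Data.Integer.Base
  open import Data.Integer.Properties
  open import Data.Integer.Tactic.RingSolver using (solve-∀)
  open import Data.Nat.Base using (z≤n; z<s)
  open import Data.Product using (_×_; _,_)
  open import Data.Sum using (inj₁; inj₂)
  open import Relation.Binary.PropositionalEquality

  0≤+ : ∀ {x y} → 0ℤ ≤ x → 0ℤ ≤ y → 0ℤ ≤ x + y
  0≤+ = +-mono-≤

  0≤* : ∀ {x y} → 0ℤ ≤ x → 0ℤ ≤ y → 0ℤ ≤ x * y
  0≤* {+ a} {+ b} _ _ = subst (0ℤ ≤_) (pos-* a b) (+≤+ z≤n)

  0<* : ∀ {x y} → 0ℤ < x → 0ℤ < y → 0ℤ < x * y
  0<* {+[1+ a ]} {+[1+ b ]} _ _ = +<+ z<s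
  0<* {+[1+ a ]} {+0} _ (+<+ ())
  0<* {+0} (+<+ ()) _

  0≤pos : ∀ {k} → 0ℤ ≤ + k
  0≤pos = +≤+ z≤n

  gap : ∀ {x y} → x ≤ y → 0ℤ ≤ y - x
  gap = i≤j⇒0≤j-i

  0<gap : ∀ {x y} → x < y → 0ℤ < y - x
  0<gap {x} {y} x<y = subst (_< y - x) (+-inverseʳ x) (+-monoˡ-< (- x) x<y)

  ≤-by : ∀ {x y} e → y - x ≡ e → 0ℤ ≤ e → x ≤ y
  ≤-by e eq 0≤e = 0≤i-j⇒j≤i (subst (0ℤ ≤_) (sym eq) 0≤e)

  <-by : ∀ {x y} e → y - x ≡ e → 0ℤ < e → x < y
  <-by {x} {y} e eq 0<e =
    subst₂ _<_ (+-identityʳ x) (lem x y) (+-monoʳ-< x (subst (0ℤ <_) (sym eq) 0<e))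
    where
    lem : ∀ x y → x + (y - x) ≡ y
    lem = solve-∀

  0≤-cancel : ∀ {c x} → 0ℤ < c → 0ℤ ≤ c * x → 0ℤ ≤ x
  0≤-cancel {c} {+ x} _ _ = +≤+ z≤n
  0≤-cancel { +[1+ c ]} { -[1+ x ]} _ ()
  0≤-cancel { +0 } { -[1+ x ]} (+<+ ()) _

  0<-cancel : ∀ {c x} → 0ℤ < c → 0ℤ < c * x → 0ℤ < x
  0<-cancel { +[1+ c ]} { +[1+ x ]} _ _ = +<+ z<s
  0<-cancel { +[1+ c ]} { +0} _ lt with () ← <-irrefl refl (subst (0ℤ <_) (*-zeroʳ +[1+ c ]) lt)
  0<-cancel { +[1+ c ]} { -[1+ x ]} _ ()
  0<-cancel { +0 } (+<+ ()) _

  ≤-cancel : ∀ {c x y} → 0ℤ < c → c * x ≤ c * y → x ≤ y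
  ≤-cancel {c} {x} {y} c>0 le = 0≤i-j⇒j≤i (0≤-cancel c>0 (subst (0ℤ ≤_) (lem c x y) (gap le)))
    where
    lem : ∀ c x y → c * y - c * x ≡ c * (y - x)
    lem = solve-∀

  <-cancel : ∀ {c x y} → 0ℤ < c → c * x < c * y → x < y
  <-cancel {c} {x} {y} c>0 lt = <-by _ refl (0<-cancel c>0 (subst (0ℤ <_) (lem c x y) (0<gap lt)))
    where
    lem : ∀ c x y → c * y - c * x ≡ c * (y - x)
    lem = solve-∀

  -- Multiplied by `X`, the difference of the two sides is a sum of products of nonnegative gaps,
  -- displayed in `lem`. The opposite order of `ξ * Y` and `X * η` is the same inequality with the
  -- two coordinates exchanged.
  crossing-half : ∀ {X Y ξ η ξ′ η′} → 0ℤ < X → 0ℤ ≤ ξ → 0ℤ ≤ η′ → ξ′ ≤ X → η′ ≤ Y →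
    (X + ξ) * η ≤ X * Y → ξ′ * η′ ≤ ξ * η → ξ * Y ≤ X * η →
    ξ′ * η′ + ξ * η′ + ξ′ * η ≤ ξ * Y + X * η
  crossing-half {X} {Y} {ξ} {η} {ξ′} {η′} X>0 ξ≥0 η′≥0 ξ′≤X η′≤Y h₁ h₂ h₃ =
    ≤-cancel X>0 (≤-by _ (lem X Y ξ η ξ′ η′)
      (0≤+ (0≤+ (0≤* (gap ξ′≤X) (0≤+ (gap h₃) (0≤* ξ≥0 (gap η′≤Y))))
                (0≤* (0≤+ (<⇒≤ X>0) ξ≥0) (gap h₂)))
           (0≤* ξ≥0 (gap h₁))))
    where
    lem : ∀ X Y ξ η ξ′ η′ →
      X * (ξ * Y + X * η) - X * (ξ′ * η′ + ξ * η′ + ξ′ * η) ≡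
      (X - ξ′) * ((X * η - ξ * Y) + ξ * (Y - η′)) + (X + ξ) * (ξ * η - ξ′ * η′)
        + ξ * (X * Y - (X + ξ) * η)
    lem = solve-∀

  -- If the scaled degree pairs (X + ξ , Y − η′) and (X − ξ′ , Y + η) of two vertices span a
  -- segment that passes above (X , Y), then the union of their neighbourhood rectangles has
  -- area at least X Y: in these variables, that is the conclusion.
  crossing : ∀ {X Y ξ η ξ′ η′} → 0ℤ < X → 0ℤ < Y → 0ℤ ≤ ξ → 0ℤ ≤ η → 0ℤ ≤ ξ′ → 0ℤ ≤ η′ →
    ξ′ ≤ X → η′ ≤ Y → (X + ξ) * η ≤ X * Y → ξ * (Y + η) ≤ X * Y → ξ′ * η′ ≤ ξ * η →
    ξ′ * η′ + ξ * η′ + ξ′ * η ≤ ξ * Y + X * η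
  crossing {X} {Y} {ξ} {η} {ξ′} {η′} X>0 Y>0 ξ≥0 η≥0 ξ′≥0 η′≥0 ξ′≤X η′≤Y h₁ h₂ h₃
    with ≤-total (ξ * Y) (X * η)
  ... | inj₁ le = crossing-half X>0 ξ≥0 η′≥0 ξ′≤X η′≤Y h₁ h₃ le
  ... | inj₂ ge = subst₂ _≤_ (swap₁ ξ η ξ′ η′) (swap₂ X Y ξ η)
    (crossing-half Y>0 η≥0 ξ′≥0 η′≤Y ξ′≤X
      (subst₂ _≤_ (*-comm ξ (Y + η)) (*-comm X Y) h₂)
      (subst₂ _≤_ (*-comm ξ′ η′) (*-comm ξ η) h₃)
      (subst₂ _≤_ (*-comm X η) (*-comm ξ Y) ge))
    where
    swap₁ : ∀ ξ η ξ′ η′ → η′ * ξ′ + η * ξ′ + η′ * ξ ≡ ξ′ * η′ + ξ * η′ + ξ′ * η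
    swap₁ = solve-∀
    swap₂ : ∀ X Y ξ η → η * X + Y * ξ ≡ ξ * Y + X * η
    swap₂ = solve-∀

  -- The bounds on d₁ + d₂ + d₃ and d₃ are those of `deletion-total`; p ≥ 5 s + 7 is where
  -- n ≥ 5 k + 2 enters.
  deletion-cost : ∀ {n p s E d₁ d₂ d₃} → 0ℤ ≤ s → 0ℤ ≤ n → 0ℤ ≤ p → 0ℤ ≤ E →
    p ≤ n → + 5 * s + + 7 ≤ p → + 3 * (n * n) ≤ + 5 * E →
    + 3 * (d₁ + d₂ + d₃) ≤ s * (+ 10 * s + + 12) → d₃ ≤ s * (+ 2 * s + + 4) →
    0ℤ ≤ d₃ →
    E * (d₁ + d₂) + n * p * d₃ ≤ p * E * s
  deletion-cost {n} {p} {s} {E} {d₁} {d₂} {d₃} s≥0 n≥0 p≥0 E≥0 p≤n s≤p nE dsum dmax d₃≥0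
    with ≤-total (n * p) E
  ... | inj₁ le = ≤-cancel {+ 3} (+<+ z<s) (≤-by _ (lem n p s E d₁ d₂ d₃)
      (0≤+ (0≤+ (0≤* (0≤* (0≤pos {3}) (gap le)) d₃≥0)
                (0≤* E≥0 (gap dsum)))
           (0≤* (0≤* E≥0 s≥0) (0≤+ (0≤+ (0≤* (0≤pos {2}) (gap s≤p)) p≥0) (0≤pos {2})))))
    where
    lem : ∀ n p s E d₁ d₂ d₃ → + 3 * (p * E * s) - + 3 * (E * (d₁ + d₂) + n * p * d₃) ≡
      + 3 * (E - n * p) * d₃ + E * (s * (+ 10 * s + + 12) - + 3 * (d₁ + d₂ + d₃))
       + E * s * (+ 2 * (p - (+ 5 * s + + 7)) + p + + 2)
    lem = solve-∀
  ... | inj₂ ge = ≤-cancel {+ 15} (+<+ z<s) (≤-by _ (lem n p s E d₁ d₂ d₃)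
      (0≤+ (0≤+ (0≤* (0≤* (0≤pos {5}) E≥0) (gap dsum))
                (0≤* (0≤* (0≤pos {15}) (gap ge)) (gap dmax)))
           (0≤* s≥0
             (0≤+ (0≤+ (0≤* (gap nE) wide)
                       (0≤* (0≤* (0≤* (0≤pos {3}) n≥0) (gap p≤n)) wide))
                  (0≤* (0≤* n≥0 p≥0)
                       (0≤+ (0≤* (0≤pos {9}) (gap s≤p))
                            (0≤+ (0≤* (0≤pos {3}) s≥0) (0≤pos {3}))))))))
    where
    wide : 0ℤ ≤ + 3 * (p - (+ 5 * s + + 7)) + (+ 11 * s + + 21)
    wide = 0≤+ (0≤* (0≤pos {3}) (gap s≤p)) (0≤+ (0≤* (0≤pos {11}) s≥0) (0≤pos {21}))
    lem : ∀ n p s E d₁ d₂ d₃ → + 15 * (p * E * s) - + 15 * (E * (d₁ + d₂) + n * p * d₃) ≡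
      + 5 * E * (s * (+ 10 * s + + 12) - + 3 * (d₁ + d₂ + d₃))
       + + 15 * (n * p - E) * (s * (+ 2 * s + + 4) - d₃)
       + s * ((+ 5 * E - + 3 * (n * n)) * (+ 3 * (p - (+ 5 * s + + 7)) + (+ 11 * s + + 21))
              + + 3 * n * (n - p) * (+ 3 * (p - (+ 5 * s + + 7)) + (+ 11 * s + + 21))
              + n * p * (+ 9 * (p - (+ 5 * s + + 7)) + (+ 3 * s + + 3)))
    lem = solve-∀

  -- The parts have sizes n − a, n − b, n − c; U, V, W bound the non-edges before the deletions.
  centre-survives : ∀ {n a b c s m U V W E d₁ d₂ d₃} →
    0ℤ ≤ a → 0ℤ ≤ b → 0ℤ ≤ c → 0ℤ ≤ s → 0ℤ ≤ U → 0ℤ ≤ V → 0ℤ ≤ d₁ → 0ℤ ≤ d₂ → 0ℤ ≤ E →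
    0ℤ < n → a < n →
    a + b + c + s ≤ m →
    (n * n - U) * (n * n - V) > n * n * W + m * n * E →
    n * n - U ≤ E → n * n - V ≤ E → U + V + m * n ≤ n * n →
    E * (d₁ + d₂) + n * (n - a) * d₃ ≤ (n - a) * E * s →
    ((n - a) * (n - b) - (U + d₁)) * ((n - a) * (n - c) - (V + d₂)) > (n - a) * (n - a) * (W + d₃)
  centre-survives {n} {a} {b} {c} {s} {m} {U} {V} {W} {E} {d₁} {d₂} {d₃}
    a≥0 b≥0 c≥0 s≥0 U≥0 V≥0 d₁≥0 d₂≥0 E≥0 n>0 a<n abc h U≤ V≤ UV cost =
    <-cancel (0<* n>0 n>0) (<-by _ eq rest>0)
    where
    p β₁ β₂ e₁ e₂ : ℤ
    p = n - a
    -- `β₁` and `β₂` are losses: p e₁ - β₁ is n times the first factor of the conclusion, and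
    -- likewise for the second.
    β₁ = n * p * b + a * U + n * d₁
    β₂ = n * p * c + a * V + n * d₂
    e₁ = n * n - U
    e₂ = n * n - V
    n≥0 : 0ℤ ≤ n
    n≥0 = <⇒≤ n>0
    p≥0 : 0ℤ ≤ p
    p≥0 = gap (<⇒≤ a<n)
    β₁≥0 : 0ℤ ≤ β₁
    β₁≥0 = 0≤+ (0≤+ (0≤* (0≤* n≥0 p≥0) b≥0) (0≤* a≥0 U≥0)) (0≤* n≥0 d₁≥0)
    β₂≥0 : 0ℤ ≤ β₂
    β₂≥0 = 0≤+ (0≤+ (0≤* (0≤* n≥0 p≥0) c≥0) (0≤* a≥0 V≥0)) (0≤* n≥0 d₂≥0)
    room : 0ℤ ≤ n * p - (U + V)
    room = subst (0ℤ ≤_) (lem n a m U V b c s)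
      (0≤+ (gap UV) (0≤* n≥0 (0≤+ (gap abc) (0≤+ (0≤+ b≥0 c≥0) s≥0))))
      where
      lem : ∀ n a m U V b c s →
        (n * n - (U + V + m * n)) + n * ((m - (a + b + c + s)) + (b + c + s)) ≡ n * (n - a) - (U + V)
      lem = solve-∀
    -- Charging losses at the rate `E` instead of `e₁`, `e₂`, each removed vertex costs at most p² n
    -- E and the deleted edges at most s p² n E. The slack m n E, scaled by p², pays for m ≥ a + b +
    -- c + s such units. Each summand of `rest` is what one of these estimates leaves over.
    rest : ℤ
    rest = β₁ * β₂ + p * (β₁ * (E - e₂) + β₂ * (E - e₁))
      + p * E * a * (n * p - (U + V))
      + n * p * (p * E * s - (E * (d₁ + d₂) + n * p * d₃))
      + p * p * n * E * (m - (a + b + c + s))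
    eq : n * n * (((n - a) * (n - b) - (U + d₁)) * ((n - a) * (n - c) - (V + d₂)))
         - n * n * ((n - a) * (n - a) * (W + d₃))
       ≡ rest + p * p * (e₁ * e₂ - (n * n * W + m * n * E))
    eq = trans (cong₂ _-_ (trans (split n _ _) (cong₂ _*_ (factor n a b U d₁) (factor n a c V d₂))) refl)
      (trans (cong (_- n * n * (p * p * (W + d₃))) (expand p E e₁ e₂ β₁ β₂))
             (collect n p a b c s m U V W E d₁ d₂ d₃ (e₁ * e₂) (β₁ * β₂ + p * (β₁ * (E - e₂) + β₂ * (E - e₁)))))
      where
      split : ∀ n x y → n * n * (x * y) ≡ (n * x) * (n * y)
      split = solve-∀
      factor : ∀ n a b U d → n * ((n - a) * (n - b) - (U + d)) ≡
        (n - a) * (n * n - U) - (n * (n - a) * b + a * U + n * d)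
      factor = solve-∀
      expand : ∀ p E e₁ e₂ β₁ β₂ → (p * e₁ - β₁) * (p * e₂ - β₂) ≡
        (β₁ * β₂ + p * (β₁ * (E - e₂) + β₂ * (E - e₁))) + p * p * (e₁ * e₂) - p * E * (β₁ + β₂)
      expand = solve-∀
      collect : ∀ n p a b c s m U V W E d₁ d₂ d₃ e r →
        r + p * p * e - p * E * ((n * p * b + a * U + n * d₁) + (n * p * c + a * V + n * d₂))
          - n * n * (p * p * (W + d₃))
        ≡ r + p * E * a * (n * p - (U + V)) + n * p * (p * E * s - (E * (d₁ + d₂) + n * p * d₃))
          + p * p * n * E * (m - (a + b + c + s)) + p * p * (e - (n * n * W + m * n * E))
      collect = solve-∀
    rest>0 : 0ℤ < rest + p * p * (e₁ * e₂ - (n * n * W + m * n * E))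
    rest>0 = +-mono-≤-<
      (0≤+ (0≤+ (0≤+ (0≤+ (0≤* β₁≥0 β₂≥0)
                          (0≤* p≥0 (0≤+ (0≤* β₁≥0 (gap V≤)) (0≤* β₂≥0 (gap U≤)))))
                     (0≤* (0≤* (0≤* p≥0 E≥0) a≥0) room))
                (0≤* (0≤* n≥0 p≥0) (gap cost)))
           (0≤* (0≤* (0≤* (0≤* p≥0 p≥0) n≥0) E≥0) (gap abc)))
      (0<* (0<* (0<gap a<n) (0<gap a<n)) (0<gap h))

  square≥0 : ∀ x → 0ℤ ≤ x * x
  square≥0 (+ n)    = 0≤* {+ n} {+ n} 0≤pos 0≤pos
  square≥0 -[1+ n ] = +≤+ z≤n

  -- σ weak and κ strong triangles, with I internal and x further deletions.
  deletion-total : ∀ {s t σ κ I x} → 0ℤ ≤ t → 0ℤ ≤ κ → t ≤ s → κ + σ ≡ t →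
    I ≡ σ * t + κ * σ → x ≤ σ * + 4 + κ * (+ 2 * s) →
    + 3 * (+ 3 * I + x) ≤ s * (+ 10 * s + + 12) × I + x ≤ s * (+ 2 * s + + 4)
  deletion-total {s} {σ = σ} {κ} {x = x} t≥0 κ≥0 t≤s refl refl x≤ =
    -- Here I = t² - κ², so both totals are quadratic in `κ`. Completing the square gives the
    -- constants 10 and 2; the squares vanish at 3 κ = s and at κ = s respectively.
    ≤-by _ (lem₁ s σ κ x)
      (0≤+ (0≤+ (0≤* (0≤pos {3}) (gap x≤)) (0≤* (gap t≤s) (0≤+ (0≤* (0≤pos {9}) (0≤+ (≤-trans t≥0 t≤s) t≥0)) (0≤pos {12}))))
           (0≤+ (square≥0 (s - + 3 * κ)) (0≤* (0≤pos {12}) κ≥0))) ,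
    ≤-by _ (lem₂ s σ κ x)
      (0≤+ (0≤+ (gap x≤) (0≤* (gap t≤s) (0≤+ (0≤+ (≤-trans t≥0 t≤s) t≥0) (0≤pos {4}))))
           (0≤+ (square≥0 (s - κ)) (0≤* (0≤pos {4}) κ≥0)))
    where
    lem₁ : ∀ s σ κ x → s * (+ 10 * s + + 12) - + 3 * (+ 3 * (σ * (κ + σ) + κ * σ) + x) ≡
      + 3 * (σ * + 4 + κ * (+ 2 * s) - x) + (s - (κ + σ)) * (+ 9 * (s + (κ + σ)) + + 12)
        + ((s - + 3 * κ) * (s - + 3 * κ) + + 12 * κ)
    lem₁ = solve-∀
    lem₂ : ∀ s σ κ x → s * (+ 2 * s + + 4) - (σ * (κ + σ) + κ * σ + x) ≡
      (σ * + 4 + κ * (+ 2 * s) - x) + (s - (κ + σ)) * (s + (κ + σ) + + 4)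
        + ((s - κ) * (s - κ) + + 4 * κ)
    lem₂ = solve-∀

  few-deletions : ∀ {n p s E d₁ d₂ d₃} → 0ℤ < E → 0ℤ ≤ n → 0ℤ ≤ p → 0ℤ ≤ d₂ → 0ℤ ≤ d₃ →
    E * (d₁ + d₂) + n * p * d₃ ≤ p * E * s → d₁ ≤ p * s
  few-deletions {n} {p} {s} {E} {d₁} {d₂} {d₃} E>0 n≥0 p≥0 d₂≥0 d₃≥0 cost =
    ≤-cancel E>0 (≤-by _ (lem n p s E d₁ d₂ d₃)
      (0≤+ (0≤+ (gap cost) (0≤* (<⇒≤ E>0) d₂≥0)) (0≤* (0≤* n≥0 p≥0) d₃≥0)))
    where
    lem : ∀ n p s E d₁ d₂ d₃ → E * (p * s) - E * d₁ ≡
      (p * E * s - (E * (d₁ + d₂) + n * p * d₃)) + E * d₂ + n * p * d₃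
    lem = solve-∀

  -- Lower bounds on two edge counts may be multiplied only once they are known to be nonnegative.
  -- The bound on `d` comes from `few-deletions`.
  edges-remain : ∀ {n a b c s m U V d} → 0ℤ ≤ n → 0ℤ ≤ a → 0ℤ ≤ b → 0ℤ ≤ c → 0ℤ ≤ s → 0ℤ ≤ V →
    a + b + c + s ≤ m → U + V + m * n ≤ n * n → d ≤ (n - a) * s →
    0ℤ ≤ (n - a) * (n - b) - (U + d)
  edges-remain {n} {a} {b} {c} {s} {m} {U} {V} {d} n≥0 a≥0 b≥0 c≥0 s≥0 V≥0 abc few d≤ =
    subst (0ℤ ≤_) (lem n a b c s m U V d)
      (0≤+ (0≤+ (0≤+ (gap few) V≥0) (0≤* n≥0 (0≤+ (gap abc) c≥0))) (0≤+ (0≤* a≥0 (0≤+ b≥0 s≥0)) (gap d≤)))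
    where
    lem : ∀ n a b c s m U V d →
      (n * n - (U + V + m * n)) + V + n * ((m - (a + b + c + s)) + c) + (a * (b + s) + ((n - a) * s - d))
      ≡ (n - a) * (n - b) - (U + d)
    lem = solve-∀

  -- After the deletions the parts have sizes n − a, n − b, n − c, and there remain X edges and u
  -- non-edges, Y edges and v non-edges, and w non-edges in the three pairs of parts.
  centre-after-deletion : ∀ {n m a b c s U V W E d₁ d₂ d₃ u v w X Y} →
    0ℤ < n → + 5 * m + + 7 ≤ n →
    0ℤ ≤ a → 0ℤ ≤ b → 0ℤ ≤ c → 0ℤ ≤ s → 0ℤ ≤ U → 0ℤ ≤ V → 0ℤ ≤ d₁ → 0ℤ ≤ d₂ → 0ℤ ≤ d₃ →
    a + b + c + s ≤ m →
    n * n * W + m * n * E < (n * n - U) * (n * n - V) →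
    n * n - U ≤ E → n * n - V ≤ E → + 3 * (n * n) ≤ + 5 * E → U + V + m * n ≤ n * n →
    + 3 * (d₁ + d₂ + d₃) ≤ s * (+ 10 * s + + 12) → d₃ ≤ s * (+ 2 * s + + 4) →
    u ≤ U + d₁ → v ≤ V + d₂ → w ≤ W + d₃ →
    X + u ≡ (n - a) * (n - b) → Y + v ≡ (n - a) * (n - c) →
    (n - a) * (n - a) * w < X * Y
  centre-after-deletion {n} {m} {a} {b} {c} {s} {U} {V} {W} {E} {d₁} {d₂} {d₃} {u} {v} {w} {X} {Y}
    n>0 n-large a≥0 b≥0 c≥0 s≥0 U≥0 V≥0 d₁≥0 d₂≥0 d₃≥0 abc slack U≤ V≤ large few-UV dsum dmax u≤ v≤ w≤ X+u Y+v =
    ≤-<-trans (≤-by _ (lem-w p (W + d₃) w) (0≤* (0≤* p≥0 p≥0) (gap w≤)))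
      (<-≤-trans
        (centre-survives a≥0 b≥0 c≥0 s≥0 U≥0 V≥0 d₁≥0 d₂≥0 E≥0 n>0 a<n abc slack U≤ V≤ few-UV cost)
        (≤-by _ (lem-XY X Y X₀ Y₀) (0≤+ (0≤* (gap X≥) (≤-trans Y₀≥0 Y≥)) (0≤* X₀≥0 (gap Y≥)))))
    where
    p X₀ Y₀ : ℤ
    p = n - a
    X₀ = p * (n - b) - (U + d₁)
    Y₀ = p * (n - c) - (V + d₂)
    E>0 : 0ℤ < E
    E>0 = 0<-cancel {+ 5} (+<+ z<s) (<-≤-trans (0<* {+ 3} (+<+ z<s) (0<* n>0 n>0)) large)
    E≥0 : 0ℤ ≤ E
    E≥0 = <⇒≤ E>0
    n≥0 : 0ℤ ≤ n
    n≥0 = <⇒≤ n>0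
    p≤n : p ≤ n
    p≤n = ≤-by a (lem n a) a≥0
      where
      lem : ∀ n a → n - (n - a) ≡ a
      lem = solve-∀
    -- Removing a vertex lowers the part by 1 but the remaining budget `s` by 1 as well, so n ≥ 5 m
    -- + 7 is inherited with 4 a to spare.
    wide : + 5 * s + + 7 ≤ p
    wide = ≤-by _ (lem n m s a b c)
      (0≤+ (0≤+ (gap n-large) (0≤* (0≤pos {5}) (0≤+ (gap abc) (0≤+ b≥0 c≥0)))) (0≤* (0≤pos {4}) a≥0))
      where
      lem : ∀ n m s a b c → n - a - (+ 5 * s + + 7) ≡
        (n - (+ 5 * m + + 7)) + + 5 * ((m - (a + b + c + s)) + (b + c)) + + 4 * a
      lem = solve-∀
    p>0 : 0ℤ < p
    p>0 = <-≤-trans (+-mono-≤-< (0≤* (0≤pos {5}) s≥0) (+<+ z<s)) wide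
    p≥0 : 0ℤ ≤ p
    p≥0 = <⇒≤ p>0
    a<n : a < n
    a<n = <-by p refl p>0
    cost : E * (d₁ + d₂) + n * p * d₃ ≤ p * E * s
    cost = deletion-cost {d₁ = d₁} {d₂} s≥0 n≥0 p≥0 E≥0 p≤n wide large dsum dmax d₃≥0
    X₀≥0 : 0ℤ ≤ X₀
    X₀≥0 = edges-remain {n} {a} {b} {c} {s} {m} {U} {V} {d₁} n≥0 a≥0 b≥0 c≥0 s≥0 V≥0 abc few-UV
      (few-deletions E>0 n≥0 p≥0 d₂≥0 d₃≥0 cost)
    Y₀≥0 : 0ℤ ≤ Y₀
    Y₀≥0 = edges-remain {n} {a} {c} {b} {s} {m} {V} {U} {d₂} n≥0 a≥0 c≥0 b≥0 s≥0 U≥0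
      (subst (_≤ m) (swap a b c s) abc) (subst (λ z → z + m * n ≤ n * n) (+-comm U V) few-UV)
      (few-deletions E>0 n≥0 p≥0 d₁≥0 d₃≥0
        (subst (λ z → E * z + n * p * d₃ ≤ p * E * s) (+-comm d₁ d₂) cost))
      where
      swap : ∀ a b c s → a + b + c + s ≡ a + c + b + s
      swap = solve-∀
    remain : ∀ {X u q D} → X + u ≡ p * q → u ≤ D → p * q - D ≤ X
    remain {X} {u} {q} {D} eq u≤ = ≤-by (D - u) (trans (cong (λ z → X - (z - D)) (sym eq)) (lem X u D)) (gap u≤)
      where
      lem : ∀ X u D → X - (X + u - D) ≡ D - u
      lem = solve-∀
    X≥ : X₀ ≤ X
    X≥ = remain X+u u≤
    Y≥ : Y₀ ≤ Y
    Y≥ = remain Y+v v≤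
    lem-w : ∀ p w v → p * p * w - p * p * v ≡ p * p * (w - v)
    lem-w = solve-∀
    lem-XY : ∀ X Y x y → X * Y - x * y ≡ (X - x) * Y + x * (Y - y)
    lem-XY = solve-∀

-- Finite sums, and the density criterion that forces a triangle.

module TriangleFreeness where

  open import Data.Bool.Base using (Bool; true; false; not)
  open import Data.Empty using (⊥)
  open import Data.Integer.Base
  open import Data.Integer.Properties
  open import Data.Integer.Tactic.RingSolver using (solve-∀)
  open import Data.List.Base using (List; []; _∷_; length; filter)
  open import Data.List.Membership.Propositional using (_∈_)
  open import Data.List.Membership.Propositional.Properties using (∈-filter⁻)
  open import Data.List.Relation.Unary.Any using (here; there)
  open import Data.Nat.Base using (z≤n)
  open import Data.Product using (_,_; proj₂)
  open import Data.Sum using (_⊎_; inj₁; inj₂)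
  open import Function.Base using (_∘_; flip)
  open import Level using (0ℓ)
  open import Relation.Binary.PropositionalEquality
  open import Relation.Nullary using (Dec; yes; no; contradiction; ¬?)
  open import Relation.Unary using (Pred; Decidable)
  open Inequalities

  ∑ : ∀ {A : Set} → List A → (A → ℤ) → ℤ
  ∑ []       f = 0ℤ
  ∑ (x ∷ xs) f = f x + ∑ xs f

  bit : Bool → ℤ
  bit true  = 1ℤ
  bit false = 0ℤ

  module _ {A : Set} where

    ∑-mono : ∀ (xs : List A) {f g} → (∀ {x} → x ∈ xs → f x ≤ g x) → ∑ xs f ≤ ∑ xs g
    ∑-mono []       f≤g = ≤-refl
    ∑-mono (x ∷ xs) f≤g = +-mono-≤ (f≤g (here refl)) (∑-mono xs (f≤g ∘ there))

    ∑-cong : ∀ (xs : List A) {f g} → (∀ x → f x ≡ g x) → ∑ xs f ≡ ∑ xs g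
    ∑-cong []       f≗g = refl
    ∑-cong (x ∷ xs) f≗g = cong₂ _+_ (f≗g x) (∑-cong xs f≗g)

    ∑-0 : ∀ (xs : List A) → ∑ xs (λ _ → 0ℤ) ≡ 0ℤ
    ∑-0 []       = refl
    ∑-0 (x ∷ xs) = trans (+-identityˡ _) (∑-0 xs)

    ∑-nonneg : ∀ (xs : List A) {f} → (∀ x → 0ℤ ≤ f x) → 0ℤ ≤ ∑ xs f
    ∑-nonneg xs {f} f≥0 = subst (_≤ ∑ xs f) (∑-0 xs) (∑-mono xs (λ {x} _ → f≥0 x))

    ∑-+ : ∀ (xs : List A) (f g : A → ℤ) → ∑ xs (λ x → f x + g x) ≡ ∑ xs f + ∑ xs g
    ∑-+ []       f g = refl
    ∑-+ (x ∷ xs) f g = trans (cong (λ s → f x + g x + s) (∑-+ xs f g)) (lem (f x) (g x) (∑ xs f) (∑ xs g))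
      where
      lem : ∀ a b c d → a + b + (c + d) ≡ a + c + (b + d)
      lem = solve-∀

    ∑-*ˡ : ∀ (xs : List A) (c : ℤ) f → ∑ xs (λ x → c * f x) ≡ c * ∑ xs f
    ∑-*ˡ []       c f = sym (*-zeroʳ c)
    ∑-*ˡ (x ∷ xs) c f = trans (cong (λ s → c * f x + s) (∑-*ˡ xs c f)) (sym (*-distribˡ-+ c (f x) (∑ xs f)))

    ∑-const : ∀ (xs : List A) c → ∑ xs (λ _ → c) ≡ + length xs * c
    ∑-const []       c = refl
    ∑-const (x ∷ xs) c = trans (cong (λ s → c + s) (∑-const xs c)) (lem c (+ length xs))
      where
      lem : ∀ c l → c + l * c ≡ (1ℤ + l) * c
      lem = solve-∀

    ∑-bit≤length : ∀ (xs : List A) (b : A → Bool) → ∑ xs (bit ∘ b) ≤ + length xs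
    ∑-bit≤length xs b = subst (∑ xs (bit ∘ b) ≤_) (trans (∑-const xs 1ℤ) (*-identityʳ _))
      (∑-mono xs (λ {x} _ → bit≤1 (b x)))
      where
      bit≤1 : ∀ b → bit b ≤ 1ℤ
      bit≤1 true  = ≤-refl
      bit≤1 false = +≤+ z≤n

    ∑-neg : ∀ (xs : List A) {f} → (∀ {x} → x ∈ xs → f x < 0ℤ) → xs ≡ [] ⊎ ∑ xs f < 0ℤ
    ∑-neg []       f<0 = inj₁ refl
    ∑-neg (x ∷ xs) f<0 with ∑-neg xs (f<0 ∘ there)
    ... | inj₁ refl = inj₂ (+-mono-<-≤ (f<0 (here refl)) ≤-refl)
    ... | inj₂ lt   = inj₂ (+-mono-< (f<0 (here refl)) lt)

    ∑-filter : ∀ {P : Pred A 0ℓ} (P? : Decidable P) (xs : List A) f →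
      ∑ (filter P? xs) f + ∑ (filter (¬? ∘ P?) xs) f ≡ ∑ xs f
    ∑-filter P? []       f = refl
    ∑-filter P? (x ∷ xs) f with P? x
    ... | yes _ = trans (+-assoc (f x) _ _) (cong (λ s → f x + s) (∑-filter P? xs f))
    ... | no _  = trans (lem (∑ (filter P? xs) f) (f x) _) (cong (λ s → f x + s) (∑-filter P? xs f))
      where
      lem : ∀ a b c → a + (b + c) ≡ b + (a + c)
      lem = solve-∀

  bit≥0 : ∀ b → 0ℤ ≤ bit b
  bit≥0 true  = +≤+ z≤n
  bit≥0 false = ≤-refl

  bit-not : ∀ b → bit b + bit (not b) ≡ 1ℤ
  bit-not true  = refl
  bit-not false = refl

  ∑-swap : ∀ {A B : Set} (xs : List A) (ys : List B) (f : A → B → ℤ) →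
    ∑ xs (λ x → ∑ ys (f x)) ≡ ∑ ys (λ y → ∑ xs (λ x → f x y))
  ∑-swap []       ys f = sym (∑-0 ys)
  ∑-swap (x ∷ xs) ys f =
    trans (cong (λ s → ∑ ys (f x) + s) (∑-swap xs ys f)) (sym (∑-+ ys (f x) _))

  ∑∑-bit≥0 : ∀ {A B : Set} (xs : List A) (ys : List B) (f : A → B → Bool) → 0ℤ ≤ ∑ xs (λ x → ∑ ys (λ y → bit (f x y)))
  ∑∑-bit≥0 xs ys f = ∑-nonneg xs (λ x → ∑-nonneg ys (λ y → bit≥0 (f x y)))

  edges nonEdges : ∀ {A B : Set} → List A → List B → (A → B → Bool) → ℤ
  edges    xs ys e = ∑ xs (λ x → ∑ ys (λ y → bit (e x y)))
  nonEdges xs ys e = ∑ xs (λ x → ∑ ys (λ y → bit (not (e x y))))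

  edges+nonEdges : ∀ {A B : Set} (xs : List A) (ys : List B) (e : A → B → Bool) →
    edges xs ys e + nonEdges xs ys e ≡ + length xs * + length ys
  edges+nonEdges xs ys e =
    trans (sym (∑-+ xs _ _))
      (trans (∑-cong xs (λ x → trans (sym (∑-+ ys _ _))
                          (trans (∑-cong ys (λ y → bit-not (e x y)))
                            (trans (∑-const ys 1ℤ) (*-identityʳ _)))))
             (∑-const xs _))

  module Centre {A B C : Set} (As : List A) (Bs : List B) (Cs : List C)
    (ab : A → B → Bool) (ac : A → C → Bool) (bc : B → C → Bool)
    (no-triangle : ∀ {a b c} → a ∈ As → b ∈ Bs → c ∈ Cs →
      ab a b ≡ true → ac a c ≡ true → bc b c ≡ true → ⊥) where

    p q r X Y U V W : ℤ
    p = + length As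
    q = + length Bs
    r = + length Cs
    X = edges As Bs ab
    Y = edges As Cs ac
    U = nonEdges As Bs ab
    V = nonEdges As Cs ac
    W = nonEdges Bs Cs bc

    x y : A → ℤ
    x a = ∑ Bs (bit ∘ ab a)
    y a = ∑ Cs (bit ∘ ac a)

    -- The deviations of the two degrees from their averages X / p and Y / p, multiplied by `p` to
    -- stay integral; both sum to zero.
    ξ η : A → ℤ
    ξ a = p * x a - X
    η a = p * y a - Y

    missing : C → ℤ
    missing c = ∑ Bs (λ b → bit (not (bc b c)))

    x≥0 : ∀ a → 0ℤ ≤ x a
    x≥0 a = ∑-nonneg Bs (bit≥0 ∘ ab a)

    y≥0 : ∀ a → 0ℤ ≤ y a
    y≥0 a = ∑-nonneg Cs (bit≥0 ∘ ac a)

    p≥0 : 0ℤ ≤ p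
    p≥0 = 0≤pos

    x≤missing : ∀ {a c} → a ∈ As → c ∈ Cs → ac a c ≡ true → x a ≤ missing c
    x≤missing {a} {c} a∈ c∈ ac≡ = ∑-mono Bs λ {b} b∈ → pointwise b (no-triangle a∈ b∈ c∈)
      where
      pointwise : ∀ b → (ab a b ≡ true → ac a c ≡ true → bc b c ≡ true → ⊥) →
        bit (ab a b) ≤ bit (not (bc b c))
      pointwise b h with ab a b | bc b c
      ... | true  | true  = contradiction refl (h refl ac≡)
      ... | true  | false = ≤-refl
      ... | false | b′    = bit≥0 (not b′)

    -- Count non-edges by their end c in C. If c is adjacent to a, all `x a` neighbours of a in B
    -- miss c; if c is adjacent only to a′, at least `x a′` vertices miss it. Subtracting x a′ y a
    -- allows for the unknown overlap of the two neighbourhoods in C, which is at most `y a`.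
    two-neighbourhoods : ∀ {a a′} → a ∈ As → a′ ∈ As → x a′ ≤ x a →
      x a * y a + x a′ * y a′ - x a′ * y a ≤ W
    two-neighbourhoods {a} {a′} a∈ a′∈ x′≤x =
      subst₂ _≤_ sum-up (∑-swap Cs Bs _) (∑-mono Cs (λ {c} c∈ → pointwise c (x≤missing a∈ c∈) (x≤missing a′∈ c∈)))
      where
      pointwise : ∀ c → (ac a c ≡ true → x a ≤ missing c) → (ac a′ c ≡ true → x a′ ≤ missing c) →
        x a * bit (ac a c) + (x a′ * bit (ac a′ c) + - x a′ * bit (ac a c)) ≤ missing c
      pointwise c h h′ with ac a c | ac a′ c
      ... | true  | true  = subst (_≤ missing c) (lem (x a) (x a′)) (h refl)
        where
        lem : ∀ x x′ → x ≡ x * 1ℤ + (x′ * 1ℤ + - x′ * 1ℤ)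
        lem = solve-∀
      ... | true  | false = ≤-trans (≤-by (x a′) (lem (x a) (x a′)) (x≥0 a′)) (h refl)
        where
        lem : ∀ x x′ → x - (x * 1ℤ + (x′ * 0ℤ + - x′ * 1ℤ)) ≡ x′
        lem = solve-∀
      ... | false | true  = subst (_≤ missing c) (lem (x a) (x a′)) (h′ refl)
        where
        lem : ∀ x x′ → x′ ≡ x * 0ℤ + (x′ * 1ℤ + - x′ * 0ℤ)
        lem = solve-∀
      ... | false | false = subst (_≤ missing c) (lem (x a) (x a′)) (∑-nonneg Bs (λ b → bit≥0 (not (bc b c))))
        where
        lem : ∀ x x′ → 0ℤ ≡ x * 0ℤ + (x′ * 0ℤ + - x′ * 0ℤ)
        lem = solve-∀
      sum-up : ∑ Cs (λ c → x a * bit (ac a c) + (x a′ * bit (ac a′ c) + - x a′ * bit (ac a c)))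
        ≡ x a * y a + x a′ * y a′ - x a′ * y a
      sum-up = trans (∑-+ Cs _ _) (trans
        (cong₂ _+_ (∑-*ˡ Cs (x a) _) (trans (∑-+ Cs _ _) (cong₂ _+_ (∑-*ˡ Cs (x a′) _) (∑-*ˡ Cs (- x a′) _))))
        (lem (x a) (x a′) (y a) (y a′)))
        where
        lem : ∀ x x′ y y′ → x * y + (x′ * y′ + - x′ * y) ≡ x * y + x′ * y′ - x′ * y
        lem = solve-∀

    module _ (p²W<XY : p * p * W < X * Y) (pqV≤ : p * q * V ≤ X * Y) (prU≤ : p * r * U ≤ X * Y) where

      X≥0 : 0ℤ ≤ X
      X≥0 = ∑∑-bit≥0 As Bs ab

      Y≥0 : 0ℤ ≤ Y
      Y≥0 = ∑∑-bit≥0 As Cs ac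

      XY>0 : 0ℤ < X * Y
      XY>0 = ≤-<-trans (0≤* (0≤* p≥0 p≥0) (∑∑-bit≥0 Bs Cs (λ b c → not (bc b c)))) p²W<XY

      X>0 : 0ℤ < X
      X>0 = ≤∧≢⇒< X≥0 (λ 0≡X → <-irrefl (cong (_* Y) 0≡X) XY>0)

      Y>0 : 0ℤ < Y
      Y>0 = ≤∧≢⇒< Y≥0 (λ 0≡Y → <-irrefl (trans (sym (*-zeroʳ X)) (cong (X *_) 0≡Y)) XY>0)

      As≢[] : As ≢ []
      As≢[] eq = <-irrefl (sym (cong (λ as → edges as Bs ab) eq)) X>0

      p>0 : 0ℤ < p
      p>0 = ≤∧≢⇒< p≥0 (λ 0≡p → As≢[] (length0 As 0≡p))
        where
        length0 : ∀ (as : List A) → 0ℤ ≡ + length as → as ≡ []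
        length0 [] _ = refl

      pair-bound : ∀ {a a′} → a ∈ As → a′ ∈ As → x a′ ≤ x a →
        (X + ξ a) * (Y + η a) + (X + ξ a′) * (Y + η a′) - (X + ξ a′) * (Y + η a) < X * Y
      pair-bound {a} {a′} a∈ a′∈ le =
        ≤-<-trans (≤-by _ (lem p X Y (x a) (x a′) (y a) (y a′) W)
                    (0≤* (0≤* p≥0 p≥0) (gap (two-neighbourhoods a∈ a′∈ le))))
                  p²W<XY
        where
        lem : ∀ p X Y x x′ y y′ W →
          p * p * W - ((X + (p * x - X)) * (Y + (p * y - Y)) + (X + (p * x′ - X)) * (Y + (p * y′ - Y))
            - (X + (p * x′ - X)) * (Y + (p * y - Y))) ≡ p * p * (W - (x * y + x′ * y′ - x′ * y))
        lem = solve-∀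

      -- The case a′ = a of `pair-bound`: a single neighbourhood rectangle with both sides at least
      -- average would already have area at least X Y / p², more than `W`.
      no-dominating : ∀ {a} → a ∈ As → 0ℤ ≤ ξ a → η a < 0ℤ
      no-dominating {a} a∈ ξ≥0 = ≰⇒> λ η≥0 → <⇒≱ (pair-bound a∈ a∈ ≤-refl)
        (≤-by _ (lem X Y (ξ a) (η a)) (0≤+ (0≤+ (0≤* X≥0 η≥0) (0≤* ξ≥0 Y≥0)) (0≤* ξ≥0 η≥0)))
        where
        lem : ∀ X Y ξ η → (X + ξ) * (Y + η) + (X + ξ) * (Y + η) - (X + ξ) * (Y + η) - X * Y
          ≡ X * η + ξ * Y + ξ * η
        lem = solve-∀

      X+ξ : ∀ a → X + ξ a ≡ p * x a
      X+ξ a = lem X (p * x a)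
        where
        lem : ∀ X z → X + (z - X) ≡ z
        lem = solve-∀

      Y+η : ∀ a → Y + η a ≡ p * y a
      Y+η a = lem Y (p * y a)
        where
        lem : ∀ X z → X + (z - X) ≡ z
        lem = solve-∀

      px≤pq : ∀ a → X + ξ a ≤ p * q
      px≤pq a = subst (_≤ p * q) (sym (X+ξ a)) (*-monoˡ-≤-nonNeg p (∑-bit≤length Bs (ab a)))

      py≤pr : ∀ a → Y + η a ≤ p * r
      py≤pr a = subst (_≤ p * r) (sym (Y+η a)) (*-monoˡ-≤-nonNeg p (∑-bit≤length Cs (ac a)))

      ξ≤U : ∀ a → ξ a ≤ U
      ξ≤U a = ≤-by _ (trans (lem X (ξ a) U) (cong (_- (X + ξ a)) (edges+nonEdges As Bs ab))) (gap (px≤pq a))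
        where
        lem : ∀ X ξ U → U - ξ ≡ (X + U) - (X + ξ)
        lem = solve-∀

      η≤V : ∀ a → η a ≤ V
      η≤V a = ≤-by _ (trans (lem Y (η a) V) (cong (_- (Y + η a)) (edges+nonEdges As Cs ac))) (gap (py≤pr a))
        where
        lem : ∀ X ξ U → U - ξ ≡ (X + U) - (X + ξ)
        lem = solve-∀

      -- The expression is the cross product of the points (ξ, η) of i and j. If it were
      -- nonnegative, the segment joining them would pass through or above the origin, and
      -- `crossing` would contradict `pair-bound`. When `η j` is negative the sign is immediate.
      crossing-pair : ∀ {i j} → i ∈ As → j ∈ As → 0ℤ ≤ ξ i → ξ j < 0ℤ → ξ i * η j - ξ j * η i < 0ℤ
      crossing-pair {i} {j} i∈ j∈ ξi≥0 ξj<0 with 0ℤ ≤? η j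
      ... | no ηj≱0 = <-by _ (lem (ξ i) (η j) (ξ j) (η i))
            (+-mono-≤-< (0≤* ξi≥0 (neg≤ (<⇒≤ (≰⇒> ηj≱0)))) (0<* (neg< ξj<0) (neg< (no-dominating i∈ ξi≥0))))
        where
        neg≤ : ∀ {z} → z ≤ 0ℤ → 0ℤ ≤ - z
        neg≤ = neg-mono-≤
        neg< : ∀ {z} → z < 0ℤ → 0ℤ < - z
        neg< = neg-mono-<
        lem : ∀ a b c d → 0ℤ - (a * b - c * d) ≡ a * (- b) + (- c) * (- d)
        lem = solve-∀
      ... | yes ηj≥0 = ≰⇒> λ ge → <⇒≱ (pair-bound i∈ j∈ xj≤xi)
            (≤-by _ (lem X Y (ξ i) (η j) (ξ j) (η i))
              (gap (crossing X>0 Y>0 ξi≥0 ηj≥0 (neg-mono-≤ (<⇒≤ ξj<0)) (neg-mono-≤ (<⇒≤ (no-dominating i∈ ξi≥0)))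
                (≤-by _ (lem₁ X (ξ j)) (subst (0ℤ ≤_) (sym (X+ξ j)) (0≤* p≥0 (x≥0 j))))
                (≤-by _ (lem₁ Y (η i)) (subst (0ℤ ≤_) (sym (Y+η i)) (0≤* p≥0 (y≥0 i))))
                -- The two side conditions of `crossing` follow from the maximal degrees and `η≤V`,
                -- `ξ≤U`. They are where it matters that neither pair at the centre has too many
                -- non-edges.
                (≤-trans (≤-by _ (lem₂ p q V (X + ξ i) (η j))
                           (0≤+ (0≤* (0≤* p≥0 (0≤pos {length Bs})) (gap (η≤V j)))
                                (0≤* (gap (px≤pq i)) ηj≥0))) pqV≤)
                (≤-trans (≤-by _ (lem₃ p r U (Y + η j) (ξ i))
                           (0≤+ (0≤* (0≤* p≥0 (0≤pos {length Cs})) (gap (ξ≤U i)))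
                                (0≤* (gap (py≤pr j)) ξi≥0))) prU≤)
                (≤-by _ (lem₄ (ξ i) (η j) (ξ j) (η i)) ge))))
        where
        xj≤xi : x j ≤ x i
        xj≤xi = ≤-cancel p>0 (subst₂ _≤_ (X+ξ j) (X+ξ i) (+-monoʳ-≤ X (≤-trans (<⇒≤ ξj<0) ξi≥0)))
        lem : ∀ X Y ξ η ξ′ η′ → (X + ξ) * (Y + η′) + (X + ξ′) * (Y + η) - (X + ξ′) * (Y + η′) - X * Y
          ≡ ξ * Y + X * η - ((- ξ′) * (- η′) + ξ * (- η′) + (- ξ′) * η)
        lem = solve-∀
        lem₁ : ∀ X ξ → X - (- ξ) ≡ X + ξ
        lem₁ = solve-∀
        lem₂ : ∀ p q V z η → p * q * V - z * η ≡ p * q * (V - η) + (p * q - z) * η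
        lem₂ = solve-∀
        lem₃ : ∀ p q V z η → p * q * V - η * z ≡ p * q * (V - η) + (p * q - z) * η
        lem₃ = solve-∀
        lem₄ : ∀ ξ η ξ′ η′ → ξ * η - (- ξ′) * (- η′) ≡ ξ * η - ξ′ * η′
        lem₄ = solve-∀

      ∑ξ : ∑ As ξ ≡ 0ℤ
      ∑ξ = trans (∑-+ As (λ a → p * x a) (λ _ → - X))
        (trans (cong₂ _+_ (∑-*ˡ As p x) (∑-const As (- X))) (lem p X))
        where
        lem : ∀ p X → p * X + p * (- X) ≡ 0ℤ
        lem = solve-∀

      ∑η : ∑ As η ≡ 0ℤ
      ∑η = trans (∑-+ As (λ a → p * y a) (λ _ → - Y))
        (trans (cong₂ _+_ (∑-*ˡ As p y) (∑-const As (- Y))) (lem p Y))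
        where
        lem : ∀ p X → p * X + p * (- X) ≡ 0ℤ
        lem = solve-∀

      high? : ∀ a → Dec (0ℤ ≤ ξ a)
      high? a = 0ℤ ≤? ξ a

      High Low : List A
      High = filter high? As
      Low  = filter (¬? ∘ high?) As

      -- By bilinearity this is the cross product of the vector sums over `High` and `Low`. These
      -- are opposite vectors, since `ξ` and `η` sum to zero over all of A.
      cross-sum : ∑ High (λ i → ∑ Low (λ j → ξ i * η j - ξ j * η i)) ≡ 0ℤ
      cross-sum = trans
        (trans (∑-cong High inner)
          (trans (∑-+ High (λ i → ∑ Low η * ξ i) (λ i → - ∑ Low ξ * η i))
            (cong₂ _+_ (∑-*ˡ High (∑ Low η) ξ) (∑-*ˡ High (- ∑ Low ξ) η))))
        (trans (lem (∑ High ξ) (∑ High η) (∑ Low ξ) (∑ Low η))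
          (trans (cong₂ (λ u v → u * ∑ Low η - ∑ Low ξ * v)
                   (trans (∑-filter high? As ξ) ∑ξ) (trans (∑-filter high? As η) ∑η))
            (lem₀ (∑ Low η) (∑ Low ξ))))
        where
        inner : ∀ i → ∑ Low (λ j → ξ i * η j - ξ j * η i) ≡ ∑ Low η * ξ i + - ∑ Low ξ * η i
        inner i = trans (∑-cong Low (λ j → flip-neg (ξ i) (η j) (ξ j) (η i)))
          (trans (∑-+ Low (λ j → ξ i * η j) (λ j → - η i * ξ j))
            (trans (cong₂ _+_ (∑-*ˡ Low (ξ i) η) (∑-*ˡ Low (- η i) ξ)) (re (ξ i) (η i) (∑ Low η) (∑ Low ξ))))
          where
          flip-neg : ∀ a b c d → a * b - c * d ≡ a * b + - d * c
          flip-neg = solve-∀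
          re : ∀ a b c d → a * c + - b * d ≡ c * a + - d * b
          re = solve-∀
        lem : ∀ h h′ l l′ → l′ * h + - l * h′ ≡ (h + l) * l′ - l * (h′ + l′)
        lem = solve-∀
        lem₀ : ∀ l l′ → 0ℤ * l - l′ * 0ℤ ≡ 0ℤ
        lem₀ = solve-∀

      -- On `High` every `η` is negative, on `Low` every `ξ` is. So if just one of the lists is
      -- empty, `∑η` or `∑ξ` fails, and if both are, p = 0. If neither is, every term of `cross-sum`
      -- is negative.
      dense-impossible : ⊥
      dense-impossible with ∑-neg High {η} (λ i∈ → let (i∈As , hi) = ∈-filter⁻ high? {xs = As} i∈ in no-dominating i∈As hi)
                    | ∑-neg Low {ξ} (λ j∈ → ≰⇒> (proj₂ (∈-filter⁻ (¬? ∘ high?) {xs = As} j∈)))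
      ... | inj₁ H≡[] | inj₁ L≡[] = <-irrefl (trans (sym (zero₂ H≡[] L≡[]))
        (trans (∑-filter high? As (λ _ → 1ℤ)) (trans (∑-const As 1ℤ) (*-identityʳ p)))) p>0
        where
        zero₂ : High ≡ [] → Low ≡ [] → ∑ High (λ _ → 1ℤ) + ∑ Low (λ _ → 1ℤ) ≡ 0ℤ
        zero₂ h l rewrite h | l = refl
      ... | inj₁ H≡[] | inj₂ l<0 = <-irrefl (trans (sym (+-identityˡ _))
        (trans (cong (λ h → ∑ h ξ + ∑ Low ξ) (sym H≡[])) (trans (∑-filter high? As ξ) ∑ξ))) l<0
      ... | inj₂ h<0 | inj₁ L≡[] = <-irrefl (trans (sym (+-identityʳ _))
        (trans (cong (λ l → ∑ High η + ∑ l η) (sym L≡[])) (trans (∑-filter high? As η) ∑η))) h<0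
      ... | inj₂ h<0 | inj₂ l<0 with ∑-neg High {λ i → ∑ Low (λ j → ξ i * η j - ξ j * η i)} row
        where
        row : ∀ {i} → i ∈ High → ∑ Low (λ j → ξ i * η j - ξ j * η i) < 0ℤ
        row {i} i∈ with ∈-filter⁻ high? {xs = As} i∈
        ... | i∈As , hi with ∑-neg Low {λ j → ξ i * η j - ξ j * η i}
                (λ j∈ → let (j∈As , lo) = ∈-filter⁻ (¬? ∘ high?) {xs = As} j∈ in crossing-pair i∈As j∈As hi (≰⇒> lo))
        ...   | inj₁ L≡[] = contradiction (cong (λ l → ∑ l ξ) L≡[]) (λ eq → <-irrefl eq l<0)
        ...   | inj₂ lt   = lt
      ...   | inj₁ H≡[] = <-irrefl (cong (λ h → ∑ h η) H≡[]) h<0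
      ...   | inj₂ lt   = <-irrefl cross-sum lt

  TriangleFree : ∀ {A B C : Set} → List A → List B → List C →
    (A → B → Bool) → (B → C → Bool) → (C → A → Bool) → Set
  TriangleFree As Bs Cs ab bc ca = ∀ {a b c} → a ∈ As → b ∈ Bs → c ∈ Cs →
    ab a b ≡ true → bc b c ≡ true → ca c a ≡ true → ⊥

  -- Cleared of denominators: the product of the two edge densities at the centre exceeds the
  -- non-edge density of the opposite pair.
  CentreDense : ∀ {A B C : Set} → List A → List B → List C →
    (A → B → Bool) → (B → C → Bool) → (C → A → Bool) → Set
  CentreDense As Bs Cs ab bc ca =
    + length As * + length As * nonEdges Bs Cs bc < edges As Bs ab * edges Cs As ca

  -- Divided by the product of the three sizes, the last two hypotheses say that the pair opposite
  -- the centre has the largest non-edge density. With density at the centre they yield the side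
  -- conditions of `dense-impossible`.
  sparsest-opposite : ∀ {A B C : Set} (As : List A) (Bs : List B) (Cs : List C)
    (ab : A → B → Bool) (bc : B → C → Bool) (ca : C → A → Bool) →
    TriangleFree As Bs Cs ab bc ca → CentreDense As Bs Cs ab bc ca →
    + length Cs * nonEdges As Bs ab ≤ + length As * nonEdges Bs Cs bc →
    + length Bs * nonEdges Cs As ca ≤ + length As * nonEdges Bs Cs bc →
    ⊥
  sparsest-opposite As Bs Cs ab bc ca free dense hU hV =
    dense-impossible dense′ (bound q V hV′) (bound r U hU)
    where
    open Centre As Bs Cs ab (flip ca) bc (λ a∈ b∈ c∈ e₁ e₂ e₃ → free a∈ b∈ c∈ e₁ e₃ e₂)
    dense′ : p * p * W < X * Y
    dense′ = subst (λ z → p * p * W < X * z) (∑-swap Cs As (λ c a → bit (ca c a))) dense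
    hV′ : q * V ≤ p * W
    hV′ = subst (λ z → q * z ≤ p * W) (∑-swap Cs As (λ c a → bit (not (ca c a)))) hV
    bound : ∀ z Z → z * Z ≤ p * W → p * z * Z ≤ X * Y
    bound z Z le = ≤-trans (≤-by _ (lem p z Z W) (0≤* p≥0 (gap le))) (<⇒≤ dense′)
      where
      lem : ∀ p z Z W → p * p * W - p * z * Z ≡ p * (p * W - z * Z)
      lem = solve-∀

  three-centres : ∀ {A B C : Set} (As : List A) (Bs : List B) (Cs : List C)
    (ab : A → B → Bool) (bc : B → C → Bool) (ca : C → A → Bool) →
    CentreDense As Bs Cs ab bc ca → CentreDense Bs Cs As bc ca ab → CentreDense Cs As Bs ca ab bc →
    TriangleFree As Bs Cs ab bc ca → ⊥
  three-centres As Bs Cs ab bc ca dA dB dC free = pick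
    (≤-total (+ length Cs * nonEdges As Bs ab) (+ length As * nonEdges Bs Cs bc))
    (≤-total (+ length As * nonEdges Bs Cs bc) (+ length Bs * nonEdges Cs As ca))
    (≤-total (+ length Bs * nonEdges Cs As ca) (+ length Cs * nonEdges As Bs ab))
    where
    -- The three non-edge densities over a common denominator; the centre opposite the largest one
    -- is used.
    u v w : ℤ
    u = + length Cs * nonEdges As Bs ab
    v = + length Bs * nonEdges Cs As ca
    w = + length As * nonEdges Bs Cs bc
    atA : u ≤ w → v ≤ w → ⊥
    atA = sparsest-opposite As Bs Cs ab bc ca free dA
    atB : w ≤ v → u ≤ v → ⊥
    atB = sparsest-opposite Bs Cs As bc ca ab (λ b∈ c∈ a∈ e₁ e₂ e₃ → free a∈ b∈ c∈ e₃ e₁ e₂) dB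
    atC : v ≤ u → w ≤ u → ⊥
    atC = sparsest-opposite Cs As Bs ca ab bc (λ c∈ a∈ b∈ e₁ e₂ e₃ → free a∈ b∈ c∈ e₂ e₃ e₁) dC
    pick : u ≤ w ⊎ w ≤ u → w ≤ v ⊎ v ≤ w → v ≤ u ⊎ u ≤ v → ⊥
    pick (inj₁ u≤w) (inj₁ w≤v) _          = atB w≤v (≤-trans u≤w w≤v)
    pick (inj₁ u≤w) (inj₂ v≤w) _          = atA u≤w v≤w
    pick (inj₂ w≤u) _          (inj₁ v≤u) = atC v≤u w≤u
    pick (inj₂ w≤u) _          (inj₂ u≤v) = atB (≤-trans w≤u u≤v) u≤v

-- From the cyclic inequalities on densities to slack in edge counts.

module CyclicCounts where

  open import Data.Integer.Base
  open import Data.Integer.Properties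
  open import Data.Integer.Tactic.RingSolver using (solve-∀)
  open import Data.Nat.Base as ℕ using (z<s; suc)
  import Data.Nat.Properties as ℕ
  import Data.Rational as ℚ
  import Data.Rational.Properties as ℚ
  import Data.Rational.Unnormalised.Base as ℚᵘ
  import Data.Rational.Unnormalised.Properties as ℚᵘ
  open import Data.Sum using (inj₁; inj₂)
  open import Relation.Binary.PropositionalEquality
  open import Relation.Nullary using (yes; no; contradiction)
  open Inequalities

  -- The cyclic inequality for the densities x / n², y / n², z / n² with δ = m / n, multiplied by
  -- n⁴.
  Above : ℤ → ℤ → ℤ → ℤ → ℤ → Set
  Above n m x y z = n * n * (n * n) < x * (y - m * n) + z * (n * n)

  clear-denominators : ∀ n .{{_ : ℕ.NonZero n}} m x y z →
    let _/n² : ℤ → ℚ.ℚ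
        i /n² = (i ℚ./ (n ℕ.* n)) {{ℕ.m*n≢0 n n}}
    in x /n² ℚ.* (y /n² ℚ.- m ℚ./ n) ℚ.+ z /n² ℚ.> ℚ.1ℚ →
    Above (+ n) m x y z
  -- The unnormalised denominators multiply to n⁷ rather than n⁴, so a factor n³ remains to be
  -- cancelled.
  clear-denominators n@(suc n′) m x y z gt = <-cancel {d ^ 3} d³>0 (subst₂ _<_ lhs rhs (drop unnormalised))
    where
    d : ℤ
    d = + n
    d³>0 : 0ℤ < d ^ 3
    d³>0 = 0<* {d} (+<+ z<s) (0<* {d} (+<+ z<s) (0<* {d} {1ℤ} (+<+ z<s) (+<+ z<s)))
    /n²ᵘ : ℤ → ℚᵘ.ℚᵘ
    /n²ᵘ i = i ℚᵘ./ (n ℕ.* n)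
    from : ∀ i → ℚ.toℚᵘ (i ℚ./ (n ℕ.* n)) ℚᵘ.≃ /n²ᵘ i
    from i = ℚ.toℚᵘ-fromℚᵘ (/n²ᵘ i)
    value : ℚᵘ.ℚᵘ
    value = /n²ᵘ x ℚᵘ.* (/n²ᵘ y ℚᵘ.- m ℚᵘ./ n) ℚᵘ.+ /n²ᵘ z
    value≃ : ℚ.toℚᵘ (x ℚ./ (n ℕ.* n) ℚ.* (y ℚ./ (n ℕ.* n) ℚ.- m ℚ./ n) ℚ.+ z ℚ./ (n ℕ.* n)) ℚᵘ.≃ value
    value≃ = ℚᵘ.≃-trans (ℚ.toℚᵘ-homo-+ (x ℚ./ (n ℕ.* n) ℚ.* (y ℚ./ (n ℕ.* n) ℚ.- m ℚ./ n)) (z ℚ./ (n ℕ.* n)))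
      (ℚᵘ.+-cong
        (ℚᵘ.≃-trans (ℚ.toℚᵘ-homo-* (x ℚ./ (n ℕ.* n)) (y ℚ./ (n ℕ.* n) ℚ.- m ℚ./ n))
          (ℚᵘ.*-cong (from x)
            (ℚᵘ.≃-trans (ℚ.toℚᵘ-homo-+ (y ℚ./ (n ℕ.* n)) (ℚ.- (m ℚ./ n)))
              (ℚᵘ.+-cong (from y)
                (ℚᵘ.≃-trans (ℚ.toℚᵘ-homo‿- (m ℚ./ n)) (ℚᵘ.-‿cong (ℚ.toℚᵘ-fromℚᵘ (m ℚᵘ./ n))))))))
        (from z))
    unnormalised : ℚᵘ.1ℚᵘ ℚᵘ.< value
    unnormalised = ℚᵘ.<-respʳ-≃ value≃ (ℚ.toℚᵘ-mono-< gt)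
    drop : ∀ {p q} → p ℚᵘ.< q → ℚᵘ.↥ p * ℚᵘ.↧ q < ℚᵘ.↥ q * ℚᵘ.↧ p
    drop (ℚᵘ.*<* lt) = lt
    n² : + (n ℕ.* n) ≡ d * d
    n² = pos-* n n
    lhs : 1ℤ * + (n ℕ.* n ℕ.* (n ℕ.* n ℕ.* n) ℕ.* (n ℕ.* n)) ≡ d ^ 3 * (d * d * (d * d))
    lhs = trans (*-identityˡ _) (trans (pos-* (n ℕ.* n ℕ.* (n ℕ.* n ℕ.* n)) (n ℕ.* n))
      (trans (cong₂ _*_ (trans (pos-* (n ℕ.* n) (n ℕ.* n ℕ.* n))
                          (cong₂ _*_ n² (trans (pos-* (n ℕ.* n) n) (cong (_* d) n²)))) n²) (lem d)))
      where
      lem : ∀ d → d * d * (d * d * d) * (d * d) ≡ d * (d * (d * 1ℤ)) * (d * d * (d * d))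
      lem = solve-∀
    rhs : ((x * (y * d + - m * + (n ℕ.* n))) * + (n ℕ.* n) + z * + (n ℕ.* n ℕ.* (n ℕ.* n ℕ.* n))) * 1ℤ
      ≡ d ^ 3 * (x * (y - m * d) + z * (d * d))
    rhs rewrite pos-* (n ℕ.* n) (n ℕ.* n ℕ.* n) | pos-* (n ℕ.* n) n | n² = lem d m x y z
      where
      lem : ∀ d m x y z → ((x * (y * d + - m * (d * d))) * (d * d) + z * (d * d * (d * d * d))) * 1ℤ
        ≡ d * (d * (d * 1ℤ)) * (x * (y - m * d) + z * (d * d))
      lem = solve-∀

  -- Divided by n⁴: the product of the densities of x and y exceeds the non-edge density of z by
  -- more than m / n times the density of `E`.
  Slack : ℤ → ℤ → ℤ → ℤ → ℤ → ℤ → Set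
  Slack n m E x y z = n * n * (n * n - z) + m * n * E < x * y

  -- One `E` serves all three centres. The `few` fields keep edge counts nonnegative after vertices
  -- and edges are removed.
  record Surplus (n m x y z : ℤ) : Set where
    field
      E : ℤ
      0≤E : 0ℤ ≤ E
      x≤E : x ≤ E
      y≤E : y ≤ E
      z≤E : z ≤ E
      large : + 3 * (n * n) ≤ + 5 * E
      slack-xy : Slack n m E x y z
      slack-yz : Slack n m E y z x
      slack-zx : Slack n m E z x y
      few-xy : (n * n - x) + (n * n - y) + m * n ≤ n * n
      few-yz : (n * n - y) + (n * n - z) + m * n ≤ n * n
      few-zx : (n * n - z) + (n * n - x) + m * n ≤ n * n

  above⇒slack : ∀ {n m x y z} → Above n m x y z → Slack n m x x y z
  above⇒slack {n} {m} {x} {y} {z} h = <-by _ (lem n m x y z) (0<gap h)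
    where
    lem : ∀ n m x y z → x * y - (n * n * (n * n - z) + m * n * x) ≡
      x * (y - m * n) + z * (n * n) - n * n * (n * n)
    lem = solve-∀

  slack-comm : ∀ {n m E x y z} → Slack n m E x y z → Slack n m E y x z
  slack-comm {n} {m} {E} {x} {y} {z} = subst (n * n * (n * n - z) + m * n * E <_) (*-comm x y)

  -- Exchanging the largest density x for z in the product costs (n² − y)(x − z) ≥ 0 at most.
  slack-exchange : ∀ {n m E x y z} → y ≤ n * n → z ≤ x → Slack n m E x y z → Slack n m E z y x
  slack-exchange {n} {m} {E} {x} {y} {z} y≤ z≤x h =
    <-by _ (lem n m E x y z) (+-mono-<-≤ (0<gap h) (0≤* (gap y≤) (gap z≤x)))
    where
    lem : ∀ n m E x y z → z * y - (n * n * (n * n - x) + m * n * E) ≡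
      (x * y - (n * n * (n * n - z) + m * n * E)) + (n * n - y) * (x - z)
    lem = solve-∀

  -- If y - m n ≥ 0, raising the factor z to n² preserves the inequality, and n² cancels. If it is
  -- negative, the product is at most 0 and x ≤ n² contradicts the hypothesis.
  few : ∀ {n m x y z} → 0ℤ < n → 0ℤ ≤ z → z ≤ n * n → x ≤ n * n → Above n m z y x →
    (n * n - x) + (n * n - y) + m * n ≤ n * n
  few {n} {m} {x} {y} {z} n>0 z≥0 z≤ x≤ h with 0ℤ ≤? y - m * n
  ... | yes pos′ = ≤-by _ (lem₁ n m x y) (0≤-cancel (0<* n>0 n>0)
      (subst (0ℤ ≤_) (lem n m x y z) (0≤+ (gap (<⇒≤ h)) (0≤* (gap z≤) pos′))))
    where
    lem₁ : ∀ n m x y → n * n - ((n * n - x) + (n * n - y) + m * n) ≡ (y - m * n) - (n * n - x)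
    lem₁ = solve-∀
    lem : ∀ n m x y z → (z * (y - m * n) + x * (n * n) - n * n * (n * n)) + (n * n - z) * (y - m * n)
      ≡ n * n * ((y - m * n) - (n * n - x))
    lem = solve-∀
  ... | no neg′ = contradiction (≤-by _ (lem n m x y z)
      (0≤+ (0≤* z≥0 (neg-mono-≤ (<⇒≤ (≰⇒> neg′)))) (0≤* (gap x≤) (<⇒≤ (0<* n>0 n>0))))) (<⇒≱ h)
    where
    lem : ∀ n m x y z → n * n * (n * n) - (z * (y - m * n) + x * (n * n)) ≡
      z * - (y - m * n) + (n * n - x) * (n * n)
    lem = solve-∀

  -- With μ = E / n² the slack gives μ² > 1 - μ, so μ exceeds the golden section (√5 - 1) / 2 > 3/5.
  -- The certificate is 25 (1 - μ - μ²) = (3 - 5 μ)(8 + 5 μ) + 1.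
  large-max : ∀ {n m E x y z} → 0ℤ < n → 0ℤ ≤ m → 0ℤ ≤ E → 0ℤ ≤ y → x ≤ E → y ≤ E → z ≤ E → Slack n m E x y z →
    + 3 * (n * n) ≤ + 5 * E
  large-max {n} {m} {E} {x} {y} {z} n>0 m≥0 E≥0 y≥0 x≤ y≤ z≤ h with + 3 * (n * n) ≤? + 5 * E
  ... | yes le = le
  ... | no nle = contradiction (≤-by _ (lem n m E x y z)
      (0≤+ (0≤+ (0≤+ (0≤* small (0≤+ (0≤* (0≤pos {8}) n²≥0) (0≤* (0≤pos {5}) E≥0))) (0≤* n²≥0 n²≥0))
                (0≤* (0≤pos {25}) (0≤+ (0≤+ (0≤* E≥0 (gap y≤)) (0≤* (gap x≤) y≥0)) (0≤* n²≥0 (gap z≤)))))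
           (0≤* (0≤* (0≤* (0≤pos {25}) m≥0) (<⇒≤ n>0)) E≥0)))
    (<⇒≱ (*-monoˡ-<-pos (+ 25) h))
    where
    n²≥0 : 0ℤ ≤ n * n
    n²≥0 = <⇒≤ (0<* n>0 n>0)
    small : 0ℤ ≤ + 3 * (n * n) - + 5 * E
    small = gap (<⇒≤ (≰⇒> nle))
    lem : ∀ n m E x y z → + 25 * (n * n * (n * n - z) + m * n * E) - + 25 * (x * y) ≡
      (+ 3 * (n * n) - + 5 * E) * (+ 8 * (n * n) + + 5 * E) + n * n * (n * n)
      + + 25 * (E * (E - y) + (E - x) * y + n * n * (E - z)) + + 25 * m * n * E
    lem = solve-∀

  rotate : ∀ {n m x y z} → Surplus n m x y z → Surplus n m y z x
  rotate S = record
    { E = E ; 0≤E = 0≤E ; x≤E = y≤E ; y≤E = z≤E ; z≤E = x≤E ; large = large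
    ; slack-xy = slack-yz ; slack-yz = slack-zx ; slack-zx = slack-xy
    ; few-xy = few-yz ; few-yz = few-zx ; few-zx = few-xy }
    where open Surplus S

  record Cyclic (n m x y z : ℤ) : Set where
    field
      x≥0 : 0ℤ ≤ x
      y≥0 : 0ℤ ≤ y
      z≥0 : 0ℤ ≤ z
      x≤n² : x ≤ n * n
      y≤n² : y ≤ n * n
      z≤n² : z ≤ n * n
      xyz : Above n m x y z
      yxz : Above n m y x z
      xzy : Above n m x z y
      zxy : Above n m z x y
      yzx : Above n m y z x
      zyx : Above n m z y x

  rotateᶜ : ∀ {n m x y z} → Cyclic n m x y z → Cyclic n m y z x
  rotateᶜ S = record
    { x≥0 = y≥0 ; y≥0 = z≥0 ; z≥0 = x≥0 ; x≤n² = y≤n² ; y≤n² = z≤n² ; z≤n² = x≤n²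
    ; xyz = yzx ; yxz = zyx ; xzy = yxz ; zxy = xyz ; yzx = zxy ; zyx = xzy }
    where open Cyclic S

  -- The two products containing the largest count `x` have slack at rate `x` directly from the
  -- cyclic inequalities; the product of y and z gets it by `slack-exchange`.
  surplus-max : ∀ {n m x y z} → 0ℤ < n → 0ℤ ≤ m → Cyclic n m x y z → y ≤ x → z ≤ x → Surplus n m x y z
  surplus-max {n} {m} {x} {y} {z} n>0 m≥0 cyc y≤x z≤x = record
    { E = x ; 0≤E = x≥0 ; x≤E = ≤-refl ; y≤E = y≤x ; z≤E = z≤x
    ; large = large-max n>0 m≥0 x≥0 y≥0 ≤-refl y≤x z≤x slack
    ; slack-xy = slack
    ; slack-yz = slack-comm {n} {m} {x} {z} {y} {x} (slack-exchange {n} {m} {x} {x} {y} {z} y≤n² z≤x slack)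
    ; slack-zx = slack-comm {n} {m} {x} {x} {z} {y} (above⇒slack {n} {m} {x} {z} {y} xzy)
    ; few-xy = few {m = m} n>0 z≥0 z≤n² x≤n² zyx
    ; few-yz = few {m = m} n>0 x≥0 x≤n² y≤n² xzy
    ; few-zx = few {m = m} n>0 y≥0 y≤n² z≤n² yxz }
    where
    open Cyclic cyc
    slack : Slack n m x x y z
    slack = above⇒slack {n} {m} {x} {y} {z} xyz

  surplus : ∀ {n m x y z} → 0ℤ < n → 0ℤ ≤ m → Cyclic n m x y z → Surplus n m x y z
  surplus {n} {m} {x} {y} {z} n>0 m≥0 C with ≤-total x y | ≤-total y z | ≤-total z x
  ... | inj₂ y≤x | _        | inj₁ z≤x = surplus-max n>0 m≥0 C y≤x z≤x
  ... | inj₂ y≤x | _        | inj₂ x≤z = rotate (surplus-max n>0 m≥0 (rotateᶜ (rotateᶜ C)) x≤z (≤-trans y≤x x≤z))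
  ... | inj₁ x≤y | inj₂ z≤y | _        = rotate (rotate (surplus-max n>0 m≥0 (rotateᶜ C) z≤y x≤y))
  ... | inj₁ x≤y | inj₁ y≤z | _        = rotate (surplus-max n>0 m≥0 (rotateᶜ (rotateᶜ C)) (≤-trans x≤y y≤z) y≤z)

-- Packings of disjoint triangles and how to enlarge them.

module DisjointTriangles where

  open import Defs
  open import Data.Empty using (⊥; ⊥-elim)
  open import Data.Fin.Base using (Fin; zero; suc)
  import Data.Fin.Properties as Fin
  open import Data.List.Base using (List; []; _∷_; _++_; length; filter; map; concatMap; allFin; cartesianProduct)
  open import Data.List.Membership.Propositional using (_∈_; _∉_; lose)
  open import Data.List.Membership.Propositional.Properties
  import Data.List.Membership.DecPropositional as DecMembership
  open import Data.List.Properties using (length-map; length-++; length-tabulate)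
  open import Data.List.Relation.Unary.Any using (here; there)
  open import Data.Nat.Base using (ℕ; zero; suc; _+_; _*_; _≤_; z≤n; s≤s)
  open import Data.Nat.Properties
  open import Data.Product using (_×_; _,_; proj₁; proj₂; Σ-syntax; ∃; ∃-syntax)
  open import Data.Product.Properties using (≡-dec)
  open import Data.Sum using (_⊎_; inj₁; inj₂; [_,_]′)
  open import Function.Base using (_∘_; case_of_)
  open import Level using (0ℓ)
  open import Relation.Binary.Definitions using (DecidableEquality)
  open import Relation.Binary.PropositionalEquality
  open import Relation.Nullary using (¬_; Dec; yes; no; contradiction; ¬?)
  open import Relation.Nullary.Decidable using (¬¬-excluded-middle)
  open import Relation.Unary using (Pred; Decidable)

  -- Case distinction on an undecided `P`, available because the goal is doubly negated.
  decide : ∀ (P : Set) {Q : Set} → (P → ¬ ¬ Q) → (¬ P → ¬ ¬ Q) → ¬ ¬ Q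
  decide P f g k = ¬¬-excluded-middle λ where
    (yes p) → f p k
    (no ¬p) → g ¬p k

  ¬¬-finite-choice : ∀ {t} {Q : Fin t → Set} → (∀ i → ¬ ¬ Q i) → ¬ ¬ (∀ i → Q i)
  ¬¬-finite-choice {zero}  q k = k λ ()
  ¬¬-finite-choice {suc t} q k =
    q zero λ q₀ → ¬¬-finite-choice (q ∘ suc) λ qs → k λ { zero → q₀ ; (suc i) → qs i }

  length-filter-¬ : ∀ {A : Set} {P : Pred A 0ℓ} (P? : Decidable P) (xs : List A) →
    length (filter P? xs) + length (filter (¬? ∘ P?) xs) ≡ length xs
  length-filter-¬ P? [] = refl
  length-filter-¬ P? (x ∷ xs) with P? x
  ... | yes _ = cong suc (length-filter-¬ P? xs)
  ... | no _  = trans (+-suc _ _) (cong suc (length-filter-¬ P? xs))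

  length-concatMap : ∀ {A B : Set} (f : A → List B) c xs → (∀ {x} → x ∈ xs → length (f x) ≤ c) →
    length (concatMap f xs) ≤ length xs * c
  length-concatMap f c []       h = z≤n
  length-concatMap f c (x ∷ xs) h = subst (_≤ c + length xs * c) (sym (length-++ (f x)))
    (+-mono-≤ (h (here refl)) (length-concatMap f c xs (h ∘ there)))

  length-cartesianProduct : ∀ {A B : Set} (xs : List A) (ys : List B) →
    length (cartesianProduct xs ys) ≡ length xs * length ys
  length-cartesianProduct []       ys = refl
  length-cartesianProduct (x ∷ xs) ys = trans (length-++ (map (x ,_) ys))
    (cong₂ _+_ (length-map (x ,_) ys) (length-cartesianProduct xs ys))

  length-allFin : ∀ t → length (allFin t) ≡ t
  length-allFin t = length-tabulate (λ i → i)

  _≟ᴾ_ : DecidableEquality Part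
  A ≟ᴾ A = yes refl
  A ≟ᴾ B = no λ ()
  A ≟ᴾ C = no λ ()
  B ≟ᴾ A = no λ ()
  B ≟ᴾ B = yes refl
  B ≟ᴾ C = no λ ()
  C ≟ᴾ A = no λ ()
  C ≟ᴾ B = no λ ()
  C ≟ᴾ C = yes refl

  _≟ⱽ_ : ∀ {n} → DecidableEquality (Vertex n)
  _≟ⱽ_ = ≡-dec _≟ᴾ_ Fin._≟_

  _∈ⱽ?_ : ∀ {n} (v : Vertex n) vs → Dec (v ∈ vs)
  _∈ⱽ?_ = DecMembership._∈?_ _≟ⱽ_

  next prev : Part → Part
  next A = B
  next B = C
  next C = A
  prev A = C
  prev B = A
  prev C = B

  next≢ : ∀ X → next X ≢ X
  next≢ A ()
  next≢ B ()
  next≢ C ()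

  prev≢ : ∀ X → prev X ≢ X
  prev≢ A ()
  prev≢ B ()
  prev≢ C ()

  next-prev : ∀ X → next (prev X) ≡ X
  next-prev A = refl
  next-prev B = refl
  next-prev C = refl

  others : ∀ {X Y} → Y ≢ X → Y ≡ next X ⊎ Y ≡ prev X
  others {A} {A} ne = contradiction refl ne
  others {A} {B} ne = inj₁ refl
  others {A} {C} ne = inj₂ refl
  others {B} {A} ne = inj₂ refl
  others {B} {B} ne = contradiction refl ne
  others {B} {C} ne = inj₁ refl
  others {C} {A} ne = inj₁ refl
  others {C} {B} ne = inj₂ refl
  others {C} {C} ne = contradiction refl ne

  third : ∀ {X Y} → X ≢ Y → ∃[ Z ] Z ≢ X × Z ≢ Y × (∀ U → U ≢ X → U ≢ Y → U ≡ Z)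
  third {X} {Y} X≢Y with others X≢Y
  ... | inj₁ refl = prev Y , p≢n Y , prev≢ Y , λ U U≢X U≢Y → [ (λ eq → contradiction eq U≢X) , (λ eq → eq) ]′ (others U≢Y)
    where
    p≢n : ∀ Y → prev Y ≢ next Y
    p≢n A ()
    p≢n B ()
    p≢n C ()
  ... | inj₂ refl = next Y , n≢p Y , next≢ Y , λ U U≢X U≢Y → [ (λ eq → eq) , (λ eq → contradiction eq U≢X) ]′ (others U≢Y)
    where
    n≢p : ∀ Y → next Y ≢ prev Y
    n≢p A ()
    n≢p B ()
    n≢p C ()

  -- One vertex per part, the shape of every triangle of G; disjointness is then tested part by
  -- part.
  Triple : ℕ → Set
  Triple n = Part → Fin n

  -- (X , i , j) is the pair of (X , i) and (next X , j), so that each pair of vertices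
  -- in different parts has exactly one code.
  Edge : ℕ → Set
  Edge n = Part × Fin n × Fin n

  _on_ : ∀ {n} → Edge n → Triple n → Set
  (X , i , j) on τ = τ X ≡ i × τ (next X) ≡ j

  -- If Y is neither X nor `next X`, then X is `next Y`, so the code starts at Y. For Y = X the
  -- value is meaningless, and `edge-on` excludes that case.
  edge : ∀ {n} → Vertex n → Vertex n → Edge n
  edge (X , i) (Y , j) with Y ≟ᴾ next X
  ... | yes _ = X , i , j
  ... | no _  = Y , j , i

  edge-on : ∀ {n X Y x y} (τ : Triple n) → Y ≢ X → τ X ≡ x → τ Y ≡ y → edge (X , x) (Y , y) on τ
  edge-on {X = X} {Y} τ Y≢X refl refl with Y ≟ᴾ next X
  ... | yes refl = refl , refl
  ... | no  Y≢nX with others Y≢X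
  ...   | inj₁ Y≡nX = contradiction Y≡nX Y≢nX
  ...   | inj₂ refl = refl , cong τ (next-prev X)

  fromPart : ∀ {E : Set} → Part → List (Part × E) → List E
  fromPart X [] = []
  fromPart X ((Y , e) ∷ es) with X ≟ᴾ Y
  ... | yes _ = e ∷ fromPart X es
  ... | no _  = fromPart X es

  ∈-fromPart : ∀ {E : Set} {X e} (es : List (Part × E)) → (X , e) ∈ es → e ∈ fromPart X es
  ∈-fromPart {X = X} ((Y , e) ∷ es) (here refl) with X ≟ᴾ X
  ... | yes _ = here refl
  ... | no ¬p = contradiction refl ¬p
  ∈-fromPart {X = X} ((Y , e) ∷ es) (there e∈) with X ≟ᴾ Y
  ... | yes _ = there (∈-fromPart es e∈)
  ... | no _  = ∈-fromPart es e∈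

  length-fromPart : ∀ {E : Set} (es : List (Part × E)) →
    length (fromPart A es) + length (fromPart B es) + length (fromPart C es) ≡ length es
  length-fromPart [] = refl
  length-fromPart ((A , e) ∷ es) = cong suc (length-fromPart es)
  length-fromPart ((B , e) ∷ es) =
    trans (cong (_+ length (fromPart C es)) (+-suc (length (fromPart A es)) _)) (cong suc (length-fromPart es))
  length-fromPart ((C , e) ∷ es) =
    trans (+-suc (length (fromPart A es) + length (fromPart B es)) _) (cong suc (length-fromPart es))

  module Packings {n : ℕ} (G : TripartiteGraph n) where
    open TripartiteGraph G

    Tri : Triple n → Set
    Tri τ = ∀ {X Y} → X ≢ Y → Adj (X , τ X) (Y , τ Y)

    Avoids : List (Vertex n) → Triple n → Set
    Avoids R τ = ∀ X → (X , τ X) ∉ R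

    record Packing (R : List (Vertex n)) (t : ℕ) : Set where
      field
        T        : Fin t → Triple n
        tri      : ∀ i → Tri (T i)
        avoids   : ∀ i → Avoids R (T i)
        disjoint : ∀ {i j} → i ≢ j → ∀ X → T i X ≢ T j X

    empty : ∀ {R} → Packing R 0
    empty = record { T = λ () ; tri = λ () ; avoids = λ () ; disjoint = λ {} }

    extend : ∀ {R t} (P : Packing R t) τ → Tri τ → Avoids R τ →
      (∀ j X → τ X ≢ Packing.T P j X) → Packing R (suc t)
    extend P τ τ-tri τ-avoids τ-disj = record
      { T        = λ { zero → τ ; (suc i) → T i }
      ; tri      = λ { zero → τ-tri ; (suc i) → tri i }
      ; avoids   = λ { zero → τ-avoids ; (suc i) → avoids i }
      ; disjoint = λ
        { {zero}  {zero}  i≢j X → contradiction refl i≢j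
        ; {zero}  {suc j} i≢j X → τ-disj j X
        ; {suc i} {zero}  i≢j X → ≢-sym (τ-disj i X)
        ; {suc i} {suc j} i≢j X → disjoint (i≢j ∘ cong suc) X } }
      where open Packing P

    replace : ∀ {R t} (P : Packing R t) i τ → Tri τ → Avoids R τ →
      (∀ j → j ≢ i → ∀ X → τ X ≢ Packing.T P j X) →
      Σ[ P′ ∈ Packing R t ] Packing.T P′ i ≡ τ × (∀ j → j ≢ i → Packing.T P′ j ≡ Packing.T P j)
    replace {R} {t} P i τ τ-tri τ-avoids τ-disj =
      record { T = T′ ; tri = tri′ ; avoids = avoids′ ; disjoint = disjoint′ } , at-i , elsewhere
      where
      open Packing P
      T′ : Fin t → Triple n
      T′ j with j Fin.≟ i
      ... | yes _ = τ
      ... | no _  = T j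
      tri′ : ∀ j → Tri (T′ j)
      tri′ j with j Fin.≟ i
      ... | yes _ = τ-tri
      ... | no _  = tri j
      avoids′ : ∀ j → Avoids R (T′ j)
      avoids′ j with j Fin.≟ i
      ... | yes _ = τ-avoids
      ... | no _  = avoids j
      disjoint′ : ∀ {j k} → j ≢ k → ∀ X → T′ j X ≢ T′ k X
      disjoint′ {j} {k} j≢k X with j Fin.≟ i | k Fin.≟ i
      ... | yes j≡i | yes k≡i = contradiction (trans j≡i (sym k≡i)) j≢k
      ... | yes _   | no k≢i  = τ-disj k k≢i X
      ... | no j≢i  | yes _   = ≢-sym (τ-disj j j≢i X)
      ... | no _    | no _    = disjoint j≢k X
      at-i : T′ i ≡ τ
      at-i with i Fin.≟ i
      ... | yes _ = refl
      ... | no ¬p = contradiction refl ¬p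
      elsewhere : ∀ j → j ≢ i → T′ j ≡ T j
      elsewhere j j≢i with j Fin.≟ i
      ... | yes j≡i = contradiction j≡i j≢i
      ... | no _    = refl

    -- Part `X` is exempt because the triangles considered all share their vertex there.
    Missing : Part → List (Vertex n) → Triple n → Set
    Missing X F τ = ∀ Y → Y ≢ X → (Y , τ Y) ∉ F

    -- Doubly negated, so that either a cover or robustness may be assumed when refuting.
    Robust : (Triple n → Set) → Part → ℕ → Set
    Robust L X c = ∀ F → length F ≤ c → ¬ ¬ (∃[ τ ] L τ × Missing X F τ)

    record Cover (L : Triple n → Set) (X : Part) (c : ℕ) : Set where
      constructor cover
      field
        F      : List (Vertex n)
        small  : length F ≤ c
        covers : ∀ τ → L τ → ∃[ Y ] Y ≢ X × (Y , τ Y) ∈ F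

    robust : ∀ {L X c} → ¬ Cover L X c → Robust L X c
    robust {L} {X} uncovered F small none = uncovered (cover F small covers)
      where
      covers : ∀ τ → L τ → ∃[ Y ] Y ≢ X × (Y , τ Y) ∈ F
      covers τ Lτ with (next X , τ (next X)) ∈ⱽ? F | (prev X , τ (prev X)) ∈ⱽ? F
      ... | yes ∈F | _      = next X , next≢ X , ∈F
      ... | no _   | yes ∈F = prev X , prev≢ X , ∈F
      ... | no ∉₁  | no ∉₂  = contradiction (τ , Lτ , missing) none
        where
        missing : Missing X F τ
        missing Y Y≢X with others Y≢X
        ... | inj₁ refl = ∉₁
        ... | inj₂ refl = ∉₂

    Through : List (Vertex n) → Vertex n → Triple n → Set
    Through R (X , x) τ = Tri τ × Avoids R τ × τ X ≡ x

    module _ {R : List (Vertex n)} where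

      -- A new triangle through the robust vertex need only avoid the 2 s packing vertices outside
      -- part X: in part X its vertex is x, which the packing avoids.
      add-robust : ∀ {s X x} → Packing ((X , x) ∷ R) s → Robust (Through R (X , x)) X (2 * s) →
        ¬ ¬ Packing R (suc s)
      add-robust {s} {X} {x} P rob none = rob F F-small λ where
          (τ , (τ-tri , τ-avoids , τX≡x) , missing) → none
            (extend P′ τ τ-tri τ-avoids λ j Y → disj τ τX≡x missing j Y)
        where
        open Packing P
        P′ : Packing R s
        P′ = record { T = T ; tri = tri ; avoids = λ i Y ∈R → avoids i Y (there ∈R) ; disjoint = disjoint }
        ends : Fin s → List (Vertex n)
        ends j = (next X , T j (next X)) ∷ (prev X , T j (prev X)) ∷ []
        F : List (Vertex n)
        F = concatMap ends (allFin s)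
        F-small : length F ≤ 2 * s
        F-small = ≤-trans (length-concatMap ends 2 (allFin s) (λ _ → ≤-refl))
          (≤-reflexive (trans (cong (_* 2) (length-allFin s)) (*-comm s 2)))
        disj : ∀ τ → τ X ≡ x → Missing X F τ → ∀ j Y → τ Y ≢ T j Y
        disj τ τX≡x missing j Y eq with Y ≟ᴾ X
        ... | yes refl = avoids j Y (here (cong (Y ,_) (trans (sym eq) τX≡x)))
        ... | no Y≢X   = missing Y Y≢X (∈-concatMap⁺ ends (lose (∈-allFin j) (subst (_∈ ends j) (cong (Y ,_) (sym eq)) (end (others Y≢X)))))
          where
          end : Y ≡ next X ⊎ Y ≡ prev X → (Y , T j Y) ∈ ends j
          end (inj₁ refl) = here refl
          end (inj₂ refl) = there (here refl)

      -- Strong and weak triangles of a maximum packing.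

      module Augment {s t : ℕ} (P : Packing R t)
        (covered : ∀ X x → (X , x) ∉ R → ¬ ¬ Cover (Through R (X , x)) X (2 * s))
        (maximum : ¬ Packing R (suc t)) where
        open Packing P

        Free : Part → Fin n → Set
        Free X x = ∀ j → x ≢ T j X

        Link : Fin t → Part → Triple n → Set
        Link i X τ = Tri τ × Avoids R τ × τ X ≡ T i X × (∀ Y → Y ≢ X → Free Y (τ Y))

        -- A strong triangle has a vertex X that can be covered afresh outside the packing, so X
        -- stays available whenever the other two vertices are needed elsewhere.
        record Strong (i : Fin t) : Set where
          constructor strong
          field
            X        : Part
            links    : Robust (Link i X) X 4
            reserved : Cover (Through R (X , T i X)) X (2 * s)

        -- Four edges suffice in each case of `classify`: no edge, three from `weak-two`, or those
        -- joining `T i X` to a cover of at most four vertices.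
        record Weak (i : Fin t) : Set where
          constructor weak
          field
            K     : List (Edge n)
            small : length K ≤ 4
            kills : ∀ X τ → Link i X τ → ∃[ e ] e ∈ K × e on τ

        Linked : Fin t → Part → Set
        Linked i X = ∃ (Link i X)

        -- Two disjoint triangles that meet the packing only in T i would enlarge it.
        crossing-links : ∀ {i X Y Z σ τ} → X ≢ Y → Z ≢ X → Z ≢ Y → (∀ U → U ≢ X → U ≢ Y → U ≡ Z) →
          Link i X σ → Link i Y τ → σ Z ≡ τ Z
        crossing-links {i} {X} {Y} {Z} {σ} {τ} X≢Y Z≢X Z≢Y only-Z
          (σ-tri , σ-avoids , σX , σ-free) (τ-tri , τ-avoids , τY , τ-free) with σ Z Fin.≟ τ Z
        ... | yes eq = eq
        ... | no ne  = contradiction (extend (proj₁ replaced) τ τ-tri τ-avoids apart) maximum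
          where
          σ-apart : ∀ j → j ≢ i → ∀ U → σ U ≢ T j U
          σ-apart j j≢i U eq with U ≟ᴾ X
          ... | yes refl = disjoint j≢i U (trans (sym eq) σX)
          ... | no U≢X   = σ-free U U≢X j eq
          replaced : Σ[ P′ ∈ Packing R t ] Packing.T P′ i ≡ σ × (∀ j → j ≢ i → Packing.T P′ j ≡ T j)
          replaced = replace P i σ σ-tri σ-avoids σ-apart
          τ-apart : ∀ j → j ≢ i → ∀ U → τ U ≢ T j U
          τ-apart j j≢i U eq with U ≟ᴾ Y
          ... | yes refl = disjoint j≢i U (trans (sym eq) τY)
          ... | no U≢Y   = τ-free U U≢Y j eq
          τ≢σ : ∀ U → τ U ≢ σ U
          τ≢σ U eq with U ≟ᴾ X | U ≟ᴾ Y
          ... | yes refl | _        = τ-free U X≢Y i (trans eq σX)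
          ... | no _     | yes refl = σ-free U (≢-sym X≢Y) i (trans (sym eq) τY)
          ... | no U≢X   | no U≢Y with only-Z U U≢X U≢Y
          ...   | refl = ne (sym eq)
          apart : ∀ j U → τ U ≢ Packing.T (proj₁ replaced) j U
          apart j U eq = case j Fin.≟ i of λ where
            (yes refl) → τ≢σ U (trans eq (cong (λ f → f U) (proj₁ (proj₂ replaced))))
            (no j≢i)   → τ-apart j j≢i U (trans eq (cong (λ f → f U) (proj₂ (proj₂ replaced) j j≢i)))

        -- For each part Z fix a link ω at another part W. By `crossing-links` every link at Z has
        -- the same vertex as ω in the third part V, so the single edge from `T i Z` to `ω V` lies
        -- on all of them.
        weak-two : ∀ {i X Y} → X ≢ Y → Linked i X → Linked i Y → Weak i
        weak-two {i} {X} {Y} X≢Y (σ , σ-link) (τ , τ-link) =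
          weak (e A ∷ e B ∷ e C ∷ []) (s≤s (s≤s (s≤s z≤n))) (λ Z ρ ρ-link → e Z , e∈ Z , proj₂ (kill Z) ρ ρ-link)
          where
          pivot : ∀ Z → ∃[ W ] Z ≢ W × Linked i W
          pivot Z with Z ≟ᴾ X
          ... | yes refl = Y , X≢Y , τ , τ-link
          ... | no Z≢X   = X , Z≢X , σ , σ-link
          kill : ∀ Z → ∃[ e ] (∀ ρ → Link i Z ρ → e on ρ)
          kill Z with pivot Z
          ... | W , Z≢W , ω , ω-link with third Z≢W
          ...   | V , V≢Z , V≢W , only-V =
                  edge (Z , T i Z) (V , ω V) , λ ρ ρ-link →
                    edge-on ρ V≢Z (proj₁ (proj₂ (proj₂ ρ-link)))
                      (crossing-links Z≢W V≢Z V≢W only-V ρ-link ω-link)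
          e : Part → Edge n
          e Z = proj₁ (kill Z)
          e∈ : ∀ Z → e Z ∈ e A ∷ e B ∷ e C ∷ []
          e∈ A = here refl
          e∈ B = there (here refl)
          e∈ C = there (there (here refl))

        edgesAt : Fin t → Part → List (Vertex n) → List (Edge n)
        edgesAt i X = map (edge (X , T i X))

        edgesAt-kill : ∀ {i X F} τ → τ X ≡ T i X → ∃[ Y ] Y ≢ X × (Y , τ Y) ∈ F →
          ∃[ e ] e ∈ edgesAt i X F × e on τ
        edgesAt-kill {i} {X} τ τX (Y , Y≢X , ∈F) =
          edge (X , T i X) (Y , τ Y) , ∈-map⁺ _ ∈F , edge-on τ Y≢X τX refl

        -- If the links at some part have no cover of size 4, T i is strong. Otherwise it is weak,
        -- by `weak-two` if links occur at two parts, and by the cover at the only linked part if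
        -- there is just one.
        classify : ∀ i → ¬ ¬ (Strong i ⊎ Weak i)
        classify i = decide (∃[ X ] ¬ Cover (Link i X) X 4)
          (λ (X , uncovered) k → covered X (T i X) (avoids i X) λ reserved →
            k (inj₁ (strong X (robust uncovered) reserved)))
          λ all-covered → decide (∃[ X ] ∃[ Y ] X ≢ Y × Linked i X × Linked i Y)
            (λ (X , Y , X≢Y , lX , lY) k → k (inj₂ (weak-two X≢Y lX lY)))
            λ no-two → decide (∃ (Linked i))
              (λ (X , lX) k → all-covered (X , λ (cover F small covers) →
                k (inj₂ (weak (edgesAt i X F) (subst (_≤ 4) (sym (length-map _ F)) small)
                  (λ Y τ τ-link → case Y ≟ᴾ X of λ where
                    (yes refl) → edgesAt-kill τ (proj₁ (proj₂ (proj₂ τ-link))) (covers τ τ-link)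
                    (no Y≢X)   → contradiction (Y , X , Y≢X , (τ , τ-link) , lX) no-two)))))
              λ none k → k (inj₂ (weak [] z≤n (λ X τ τ-link → contradiction (X , τ , τ-link) none)))

        -- The edges to delete, and how many there are.

        module Deletion (classes : ∀ i → Strong i ⊎ Weak i) where

          IsStrong : Fin t → Set
          IsStrong i = ∃[ S ] classes i ≡ inj₁ S

          isStrong? : ∀ i → Dec (IsStrong i)
          isStrong? i with classes i
          ... | inj₁ S = yes (S , refl)
          ... | inj₂ _ = no λ ()

          strongs weaks : List (Fin t)
          strongs = filter isStrong? (allFin t)
          weaks   = filter (¬? ∘ isStrong?) (allFin t)

          -- All index pairs that are not both strong.
          pairs : List (Fin t × Fin t)
          pairs = cartesianProduct weaks (allFin t) ++ cartesianProduct strongs weaks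

          extra : Fin t → List (Edge n)
          extra i with classes i
          ... | inj₁ (strong X _ (cover F _ _)) = edgesAt i X F
          ... | inj₂ (weak K _ _)               = K

          extras : List (Edge n)
          extras = concatMap extra weaks ++ concatMap extra strongs

          deleted : Part → List (Fin n × Fin n)
          deleted X = map (λ (i , j) → T i X , T j (next X)) pairs ++ fromPart X extras

          extra⊆deleted : ∀ i {X e} → (X , e) ∈ extra i → e ∈ deleted X
          extra⊆deleted i {X} ∈e = ∈-++⁺ʳ _ (∈-fromPart extras (in-extras (isStrong? i)))
            where
            in-extras : Dec (IsStrong i) → _ ∈ extras
            in-extras (yes s) = ∈-++⁺ʳ _ (∈-concatMap⁺ extra (lose (∈-filter⁺ isStrong? (∈-allFin i) s) ∈e))
            in-extras (no w)  = ∈-++⁺ˡ (∈-concatMap⁺ extra (lose (∈-filter⁺ (¬? ∘ isStrong?) (∈-allFin i) w) ∈e))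

          pair⊆deleted : ∀ i j X → ¬ IsStrong i ⊎ ¬ IsStrong j → (T i X , T j (next X)) ∈ deleted X
          pair⊆deleted i j X w = ∈-++⁺ˡ (∈-map⁺ (λ (i , j) → T i X , T j (next X)) (in-pairs w))
            where
            in-pairs : ¬ IsStrong i ⊎ ¬ IsStrong j → (i , j) ∈ pairs
            in-pairs (inj₁ wi) = ∈-++⁺ˡ (∈-cartesianProduct⁺ (∈-filter⁺ (¬? ∘ isStrong?) (∈-allFin i) wi) (∈-allFin j))
            in-pairs (inj₂ wj) with isStrong? i
            ... | no wi = ∈-++⁺ˡ (∈-cartesianProduct⁺ (∈-filter⁺ (¬? ∘ isStrong?) (∈-allFin i) wi) (∈-allFin j))
            ... | yes si = ∈-++⁺ʳ _ (∈-cartesianProduct⁺ (∈-filter⁺ isStrong? (∈-allFin i) si)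
                                       (∈-filter⁺ (¬? ∘ isStrong?) (∈-allFin j) wj))

          strongs+weaks : length strongs + length weaks ≡ t
          strongs+weaks = trans (length-filter-¬ isStrong? (allFin t)) (length-allFin t)

          length-pairs : length pairs ≡ length weaks * t + length strongs * length weaks
          length-pairs = trans (length-++ (cartesianProduct weaks (allFin t)))
            (cong₂ _+_ (trans (length-cartesianProduct weaks (allFin t)) (cong (length weaks *_) (length-allFin t)))
                       (length-cartesianProduct strongs weaks))

          length-deleted : ∀ X → length (deleted X) ≡ length pairs + length (fromPart X extras)
          length-deleted X = trans (length-++ (map (λ (i , j) → T i X , T j (next X)) pairs))
            (cong (_+ length (fromPart X extras)) (length-map _ pairs))

          length-extras : length extras ≤ length weaks * 4 + length strongs * (2 * s)
          length-extras = subst (_≤ length weaks * 4 + length strongs * (2 * s))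
            (sym (length-++ (concatMap extra weaks)))
            (+-mono-≤ (length-concatMap extra 4 weaks (λ {i} i∈ → weak-extra i (proj₂ (∈-filter⁻ (¬? ∘ isStrong?) {xs = allFin t} i∈))))
                      (length-concatMap extra (2 * s) strongs (λ {i} i∈ → strong-extra i (proj₂ (∈-filter⁻ isStrong? {xs = allFin t} i∈)))))
            where
            weak-extra : ∀ i → ¬ IsStrong i → length (extra i) ≤ 4
            weak-extra i ¬s with classes i
            ... | inj₁ S = contradiction (S , refl) ¬s
            ... | inj₂ (weak K small _) = small
            strong-extra : ∀ i → IsStrong i → length (extra i) ≤ 2 * s
            strong-extra i (S , eq) with classes i
            strong-extra i (strong X _ (cover F small _) , refl) | inj₁ _ = subst (_≤ 2 * s) (sym (length-map _ F)) small

          -- A triangle surviving the deletions enlarges the packing.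

          module Survivor (τ : Triple n) (τ-tri : Tri τ) (τ-avoids : Avoids R τ)
            (survives : ∀ X → (τ X , τ (next X)) ∉ deleted X) where

            Hit : Part → Fin t → Set
            Hit X i = τ X ≡ T i X

            hit? : ∀ X → Dec (∃ (Hit X))
            hit? X = Fin.any? (λ i → τ X Fin.≟ T i X)

            on-extra : ∀ {i e} → e ∈ extra i → e on τ → ⊥
            on-extra {i} {X , _} ∈e (refl , refl) = survives X (extra⊆deleted i ∈e)

            weak-pair : ∀ {X Y i j} → Y ≢ X → Hit X i → Hit Y j → ¬ IsStrong i → ⊥
            weak-pair {X} {Y} {i} {j} Y≢X hX hY wi with others Y≢X
            ... | inj₁ refl = survives X (subst₂ (λ x y → (x , y) ∈ deleted X) (sym hX) (sym hY)
                                (pair⊆deleted i j X (inj₁ wi)))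
            ... | inj₂ refl = survives Y (subst₂ (λ x y → (x , y) ∈ deleted Y) (sym hY)
                                (trans (cong (T i) (next-prev X)) (trans (sym hX) (cong τ (sym (next-prev X)))))
                                (pair⊆deleted j i Y (inj₂ wi)))

            -- If T i were weak, the deleted edges between T i and the other triangles would leave τ
            -- meeting the packing only in T i. Then τ is a link and contains an edge of `K`, which
            -- is deleted too.
            hit-strong : ∀ {X i} → Hit X i → IsStrong i
            hit-strong {X} {i} hX with classes i in eq
            ... | inj₁ S = S , refl
            ... | inj₂ (weak K _ kills) = ⊥-elim (let (e , e∈ , e-on) = kills X τ link in
                    on-extra {i} (subst (e ∈_) extra≡ e∈) e-on)
              where
              not-strong : ¬ IsStrong i
              not-strong (S , eq′) with () ← trans (sym eq) eq′
              link : Link i X τ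
              link = (λ {X} {Y} → τ-tri {X} {Y}) , τ-avoids , hX , λ Y Y≢X j hY → weak-pair Y≢X hX hY not-strong
              extra≡ : K ≡ extra i
              extra≡ rewrite eq = refl

            -- A triangle through the reserved vertex meets its cover, and the edges from that
            -- vertex to the cover are deleted.
            not-reserved : ∀ {i S} → classes i ≡ inj₁ S → τ (Strong.X S) ≢ T i (Strong.X S)
            not-reserved {i} {S@(strong X links (cover F small covers))} eq hX =
              let (e , e∈ , e-on) = edgesAt-kill τ hX (covers τ ((λ {X} {Y} → τ-tri {X} {Y}) , τ-avoids , hX))
              in on-extra {i} (subst (e ∈_) extra≡ e∈) e-on
              where
              extra≡ : edgesAt i X F ≡ extra i
              extra≡ rewrite eq = refl

            -- P′ is P with some T i replaced by triangles through their reserved vertices; the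
            -- list F holds the new vertices and those of τ outside V(P), and Xs the parts in
            -- which τ may still meet P′.
            clear : (Xs : List Part) (F : List (Vertex n)) (P′ : Packing R t) →
              length F + 2 * length Xs ≤ 6 →
              (∀ {X} → X ∈ Xs → ∃ (Hit X)) →
              (∀ X → X ∈ Xs ⊎ (∀ j → τ X ≢ Packing.T P′ j X)) →
              (∀ j Y → Packing.T P′ j Y ≡ T j Y ⊎ (Y , Packing.T P′ j Y) ∈ F) →
              (∀ {Y y} → (Y , y) ∈ F → Free Y y) →
              (∀ Y → (Y , τ Y) ∈ F ⊎ ∃ (Hit Y)) → ⊥
            clear [] F P′ _ _ disj _ _ _ = maximum (extend P′ τ τ-tri τ-avoids λ j X →
              [ (λ ()) , (λ h → h j) ]′ (disj X))
            clear (X ∷ Xs) F P′ budget hits disj old F-free τ-place with Fin.any? (λ i → τ X Fin.≟ Packing.T P′ i X)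
            ... | no unhit = clear Xs F P′ (≤-trans (+-monoʳ-≤ (length F) (*-monoʳ-≤ 2 (n≤1+n _))) budget) (hits ∘ there)
                    (λ Y → case disj Y of λ where
                      (inj₁ (here refl)) → inj₂ λ j eq → unhit (j , eq)
                      (inj₁ (there Y∈))  → inj₁ Y∈
                      (inj₂ h)           → inj₂ h)
                    old F-free τ-place
            ... | yes (i , eq) = by-strong (hit-strong hit-i)
              where
              open Packing P′ using () renaming (T to T′; disjoint to disjoint′)
              -- The vertex of P′ met here is an old one: new vertices in `F` lie outside the
              -- original packing, whereas τ meets that packing in part X. So the same T i was hit
              -- originally.
              hit-i : Hit X i
              hit-i with old i X
              ... | inj₁ T′≡T = trans eq T′≡T
              ... | inj₂ ∈F with hits (here refl)
              ...   | k , hX = contradiction (trans (sym eq) hX) (F-free ∈F k)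
              budget′ : length F + (2 + 2 * length Xs) ≤ 6
              budget′ = subst (λ z → length F + z ≤ 6) (*-suc 2 (length Xs)) budget
              by-strong : IsStrong i → ⊥
              by-strong (S@(strong Z links _) , S-eq) = links F F≤4 use
                where
                -- Two of the six units of budget are held back for the part X being treated, which
                -- leaves `F` within the robustness 4 of the links.
                F≤4 : length F ≤ 4
                F≤4 = +-cancelʳ-≤ 2 (length F) 4 (≤-trans (+-monoʳ-≤ (length F) (m≤m+n 2 _)) budget′)
                use : ¬ (∃[ ρ ] Link i Z ρ × Missing Z F ρ)
                use (ρ , (ρ-tri , ρ-avoids , ρZ , ρ-free) , ρ-missing) =
                  clear Xs F′ (proj₁ replaced)
                    (≤-trans (≤-reflexive (trans (sym (+-assoc 2 (length F) _))
                      (trans (cong (_+ 2 * length Xs) (+-comm 2 (length F))) (+-assoc (length F) 2 _)))) budget′)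
                    (hits ∘ there) disj′ old′ F′-free (λ Y → case τ-place Y of λ where
                      (inj₁ ∈F)  → inj₁ (there (there ∈F))
                      (inj₂ hit) → inj₂ hit)
                  where
                  F′ : List (Vertex n)
                  F′ = (next Z , ρ (next Z)) ∷ (prev Z , ρ (prev Z)) ∷ F
                  ρ-apart : ∀ j → j ≢ i → ∀ Y → ρ Y ≢ T′ j Y
                  ρ-apart j j≢i Y eq with Y ≟ᴾ Z | old j Y
                  ... | yes refl | inj₁ T′≡T = disjoint j≢i Y (trans (sym T′≡T) (trans (sym eq) ρZ))
                  ... | yes refl | inj₂ ∈F   = F-free ∈F i (trans (sym eq) ρZ)
                  ... | no Y≢Z   | inj₁ T′≡T = ρ-free Y Y≢Z j (trans eq T′≡T)
                  ... | no Y≢Z   | inj₂ ∈F   = ρ-missing Y Y≢Z (subst (λ y → (Y , y) ∈ F) (sym eq) ∈F)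
                  replaced : Σ[ P″ ∈ Packing R t ] Packing.T P″ i ≡ ρ × (∀ j → j ≢ i → Packing.T P″ j ≡ T′ j)
                  replaced = replace P′ i ρ ρ-tri ρ-avoids ρ-apart
                  T″ : Fin t → Triple n
                  T″ = Packing.T (proj₁ replaced)
                  at-i : ∀ Y → T″ i Y ≡ ρ Y
                  at-i Y = cong (λ f → f Y) (proj₁ (proj₂ replaced))
                  elsewhere : ∀ j → j ≢ i → ∀ Y → T″ j Y ≡ T′ j Y
                  elsewhere j j≢i Y = cong (λ f → f Y) (proj₂ (proj₂ replaced) j j≢i)
                  -- In part Z, τ misses the reserved vertex. In the other parts τ is either in `F`,
                  -- which ρ misses, or in the original packing, which ρ meets only in part Z.
                  τ≢ρ : ∀ Y → τ Y ≢ ρ Y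
                  τ≢ρ Y eq with Y ≟ᴾ Z | τ-place Y
                  ... | yes refl | _             = not-reserved S-eq (trans eq ρZ)
                  ... | no Y≢Z   | inj₁ ∈F       = ρ-missing Y Y≢Z (subst (λ y → (Y , y) ∈ F) eq ∈F)
                  ... | no Y≢Z   | inj₂ (j , hY) = ρ-free Y Y≢Z j (trans (sym eq) hY)
                  disj′ : ∀ Y → Y ∈ Xs ⊎ (∀ j → τ Y ≢ T″ j Y)
                  disj′ Y = case disj Y of λ where
                      (inj₁ (here refl)) → inj₂ (away λ j j≢i τ≡ → disjoint′ j≢i X (trans (sym τ≡) eq))
                      (inj₁ (there Y∈))  → inj₁ Y∈
                      (inj₂ h)           → inj₂ (away λ j _ → h j)
                    where
                    away : (∀ j → j ≢ i → τ Y ≢ T′ j Y) → ∀ j → τ Y ≢ T″ j Y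
                    away h j τ≡ = case j Fin.≟ i of λ where
                      (yes refl) → τ≢ρ Y (trans τ≡ (at-i Y))
                      (no j≢i)   → h j j≢i (trans τ≡ (elsewhere j j≢i Y))
                  old′ : ∀ j Y → T″ j Y ≡ T j Y ⊎ (Y , T″ j Y) ∈ F′
                  old′ j Y = case j Fin.≟ i of λ where
                      (yes refl) → old-i (Y ≟ᴾ Z)
                      (no j≢i)   → [ (λ T′≡T → inj₁ (trans (elsewhere j j≢i Y) T′≡T))
                                   , (λ ∈F → inj₂ (there (there (subst (λ y → (Y , y) ∈ F) (sym (elsewhere j j≢i Y)) ∈F))))
                                   ]′ (old j Y)
                    where
                    old-i : Dec (Y ≡ Z) → T″ i Y ≡ T i Y ⊎ (Y , T″ i Y) ∈ F′
                    old-i (yes refl) = inj₁ (trans (at-i Y) ρZ)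
                    old-i (no Y≢Z) with others Y≢Z
                    ... | inj₁ refl = inj₂ (here (cong (Y ,_) (at-i Y)))
                    ... | inj₂ refl = inj₂ (there (here (cong (Y ,_) (at-i Y))))
                  F′-free : ∀ {Y y} → (Y , y) ∈ F′ → Free Y y
                  F′-free (here refl)         = ρ-free _ (next≢ Z)
                  F′-free (there (here refl)) = ρ-free _ (prev≢ Z)
                  F′-free (there (there ∈F))  = F-free ∈F

            no-survivor : ⊥
            no-survivor = clear hitParts (map (λ X → X , τ X) freeParts) P budget
              (λ X∈ → proj₂ (∈-filter⁻ hit? {xs = parts} X∈))
              (λ X → case hit? X of λ where
                (yes h) → inj₁ (∈-filter⁺ hit? (∈-parts X) h)
                (no ¬h) → inj₂ λ j eq → ¬h (j , eq))
              (λ _ _ → inj₁ refl)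
              (λ ∈F → free (∈-map⁻ _ ∈F))
              (λ X → case hit? X of λ where
                (yes h) → inj₂ h
                (no ¬h) → inj₁ (∈-map⁺ (λ X → X , τ X) (∈-filter⁺ (¬? ∘ hit?) (∈-parts X) ¬h)))
              where
              parts hitParts freeParts : List Part
              parts     = A ∷ B ∷ C ∷ []
              hitParts  = filter hit? parts
              freeParts = filter (¬? ∘ hit?) parts
              ∈-parts : ∀ X → X ∈ parts
              ∈-parts A = here refl
              ∈-parts B = there (here refl)
              ∈-parts C = there (there (here refl))
              free : ∀ {Y y} → ∃[ X ] X ∈ freeParts × (Y , y) ≡ (X , τ X) → Free Y y
              free (X , X∈ , refl) j eq = proj₂ (∈-filter⁻ (¬? ∘ hit?) {xs = parts} X∈) (j , eq)
              -- A free part puts one vertex into `F` and a hit part holds back two, so three parts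
              -- stay within 6.
              budget : length (map (λ X → X , τ X) freeParts) + 2 * length hitParts ≤ 6
              budget = ≤-trans (+-monoˡ-≤ (2 * length hitParts)
                  (≤-trans (≤-reflexive (length-map _ freeParts)) (m≤n*m (length freeParts) 2)))
                (≤-reflexive (trans (sym (*-distribˡ-+ 2 (length freeParts) (length hitParts)))
                  (cong (2 *_) (trans (+-comm (length freeParts) _) (length-filter-¬ hit? parts)))))

-- Edge counts of the graph, and the refutation assembled from the previous parts.

module Counting where

  open import Defs
  open import Data.Bool.Base using (Bool; true; false; not; _∧_)
  open import Data.Empty using (⊥)
  open import Data.Fin.Base using (Fin)
  import Data.Fin.Properties as Fin
  open import Data.Integer.Base hiding (suc)
  open import Data.Integer.Properties
  open import Data.Integer.Tactic.RingSolver using (solve-∀)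
  open import Data.List.Base using (List; []; _∷_; _++_; length; filter; map; allFin; cartesianProduct)
  open import Data.List.Membership.Propositional using (_∈_; _∉_)
  open import Data.List.Membership.Propositional.Properties using (∈-filter⁻)
  import Data.List.Membership.DecPropositional as DecMembership
  open import Data.List.Relation.Unary.All using (All; []; _∷_)
  open import Data.List.Relation.Unary.AllPairs using ([]; _∷_)
  open import Data.List.Relation.Unary.Any using (here; there)
  open import Data.List.Relation.Unary.Unique.Propositional using (Unique)
  import Data.List.Relation.Unary.Unique.Propositional.Properties as Unique
  open import Data.Nat.Base as ℕ using (ℕ; zero; suc; z≤n; s≤s)
  import Data.Nat.Properties as ℕ
  open import Data.Product using (_×_; _,_; proj₁; proj₂; ∃; ∃-syntax)
  open import Data.Product.Properties using (≡-dec)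
  import Data.Rational as ℚ
  open import Data.Sum using (_⊎_; inj₁; inj₂)
  open import Data.Vec.Base using (Vec; []; _∷_; lookup; tabulate)
  open import Data.Vec.Properties using (lookup∘tabulate)
  open import Function.Base using (_∘_; case_of_)
  open import Level using (0ℓ)
  open import Relation.Binary.Definitions using (DecidableEquality)
  open import Relation.Binary.PropositionalEquality
  open import Relation.Nullary using (¬_; Dec; yes; no; does; contradiction; ¬?)
  open import Relation.Nullary.Decidable using (_×-dec_; _⊎-dec_; map′; decidable-stable)
  open import Relation.Unary using (Pred; Decidable)
  open Inequalities
  open TriangleFreeness
  open CyclicCounts
  open DisjointTriangles

  bit-mono : ∀ {P Q : Set} (P? : Dec P) (Q? : Dec Q) → (P → Q) → bit (does P?) ≤ bit (does Q?)
  bit-mono (yes p) (yes q) f = ≤-refl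
  bit-mono (yes p) (no ¬q) f = contradiction (f p) ¬q
  bit-mono (no ¬p) Q?      f = bit≥0 (does Q?)

  module _ {A : Set} where

    length-filter-∑ : ∀ {P : Pred A 0ℓ} (P? : Decidable P) (xs : List A) →
      + length (filter P? xs) ≡ ∑ xs (λ x → bit (does (P? x)))
    length-filter-∑ P? [] = refl
    length-filter-∑ P? (x ∷ xs) with P? x
    ... | yes _ = cong (λ z → 1ℤ + z) (length-filter-∑ P? xs)
    ... | no _  = trans (length-filter-∑ P? xs) (sym (+-identityˡ _))

    ∑-filter≤ : ∀ {P : Pred A 0ℓ} (P? : Decidable P) (xs : List A) {f} → (∀ x → 0ℤ ≤ f x) →
      ∑ (filter P? xs) f ≤ ∑ xs f
    ∑-filter≤ P? xs {f} f≥0 = subst (∑ (filter P? xs) f ≤_) (∑-filter P? xs f)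
      (subst (_≤ ∑ (filter P? xs) f + ∑ (filter (¬? ∘ P?) xs) f) (+-identityʳ _)
        (+-monoʳ-≤ (∑ (filter P? xs) f) (∑-nonneg (filter (¬? ∘ P?) xs) f≥0)))

    ∑-++ : ∀ (xs ys : List A) f → ∑ (xs ++ ys) f ≡ ∑ xs f + ∑ ys f
    ∑-++ []       ys f = sym (+-identityˡ _)
    ∑-++ (x ∷ xs) ys f = trans (cong (λ z → f x + z) (∑-++ xs ys f)) (sym (+-assoc (f x) _ _))

    ∑-map : ∀ {B : Set} (g : B → A) ys f → ∑ (map g ys) f ≡ ∑ ys (f ∘ g)
    ∑-map g []       f = refl
    ∑-map g (y ∷ ys) f = cong (λ z → f (g y) + z) (∑-map g ys f)

    module _ (_≟_ : DecidableEquality A) where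
      open DecMembership _≟_ using (_∈?_)

      ∑-≟ : ∀ {xs} → Unique xs → ∀ a → ∑ xs (λ x → bit (does (x ≟ a))) ≤ 1ℤ
      ∑-≟ [] a = +≤+ z≤n
      ∑-≟ {x ∷ xs} (x∉ ∷ uniq) a with x ≟ a
      ... | yes refl = ≤-reflexive (cong (λ z → 1ℤ + z) (absent xs x∉))
        where
        absent : ∀ ys → All (x ≢_) ys → ∑ ys (λ y → bit (does (y ≟ x))) ≡ 0ℤ
        absent []       []        = refl
        absent (y ∷ ys) (x≢y ∷ h) with y ≟ x
        ... | yes y≡x = contradiction (sym y≡x) x≢y
        ... | no _    = trans (+-identityˡ _) (absent ys h)
      ... | no _ = subst (_≤ 1ℤ) (sym (+-identityˡ _)) (∑-≟ uniq a)

      -- `D` may contain repetitions, as the lists of removed vertices and deleted edges can; they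
      -- only weaken the bound.
      ∑-∈ : ∀ {xs} → Unique xs → ∀ D → ∑ xs (λ x → bit (does (x ∈? D))) ≤ + length D
      ∑-∈ {xs} uniq [] = ≤-reflexive (trans (∑-cong xs (λ x → outside x)) (∑-0 xs))
        where
        outside : ∀ x → bit (does (x ∈? [])) ≡ 0ℤ
        outside x with x ∈? []
        ... | no _ = refl
      ∑-∈ {xs} uniq (d ∷ D) = ≤-trans
        (subst (∑ xs (λ x → bit (does (x ∈? (d ∷ D)))) ≤_) (∑-+ xs _ _)
          (∑-mono xs (λ {x} _ → split x)))
        (+-mono-≤ (∑-≟ uniq d) (∑-∈ uniq D))
        where
        split : ∀ x → bit (does (x ∈? (d ∷ D))) ≤ bit (does (x ≟ d)) + bit (does (x ∈? D))
        split x with x ≟ d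
        ... | yes _ = +-monoʳ-≤ 1ℤ (bit≥0 (does (x ∈? D)))
        ... | no _  = ≤-reflexive (sym (+-identityˡ _))

  ∑-cartesianProduct : ∀ {A B : Set} (xs : List A) (ys : List B) f →
    ∑ (cartesianProduct xs ys) f ≡ ∑ xs (λ x → ∑ ys (λ y → f (x , y)))
  ∑-cartesianProduct []       ys f = refl
  ∑-cartesianProduct (x ∷ xs) ys f = trans (∑-++ (map (x ,_) ys) _ f)
    (cong₂ _+_ (∑-map (x ,_) ys f) (∑-cartesianProduct xs ys f))

  nonEdges-filter : ∀ {A B : Set} {P : Pred A 0ℓ} {Q : Pred B 0ℓ} (P? : Decidable P) (Q? : Decidable Q)
    (xs : List A) (ys : List B) e → nonEdges (filter P? xs) (filter Q? ys) e ≤ nonEdges xs ys e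
  nonEdges-filter P? Q? xs ys e = ≤-trans
    (∑-mono (filter P? xs) (λ {x} _ → ∑-filter≤ Q? ys (λ y → bit≥0 (not (e x y)))))
    (∑-filter≤ P? xs (λ x → ∑-nonneg ys (λ y → bit≥0 (not (e x y)))))

  nonEdges-∧ : ∀ {A B : Set} (xs : List A) (ys : List B) (e d : A → B → Bool) →
    nonEdges xs ys (λ x y → e x y ∧ not (d x y)) ≤ nonEdges xs ys e + edges xs ys d
  nonEdges-∧ xs ys e d = subst (nonEdges xs ys (λ x y → e x y ∧ not (d x y)) ≤_) (∑-+ xs _ _)
    (∑-mono xs (λ {x} _ → subst (∑ ys (λ y → bit (not (e x y ∧ not (d x y)))) ≤_) (∑-+ ys _ _)
      (∑-mono ys (λ {y} _ → pointwise (e x y) (d x y)))))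
    where
    pointwise : ∀ a b → bit (not (a ∧ not b)) ≤ bit (not a) + bit b
    pointwise true  true  = ≤-refl
    pointwise true  false = ≤-refl
    pointwise false b     = +-monoʳ-≤ 1ℤ (bit≥0 b)

  module Glue {n : ℕ} (G : TripartiteGraph n) where
    open TripartiteGraph G
    open Packings G

    N : ℤ
    N = + n

    all : List (Fin n)
    all = allFin n

    adj : Part → Fin n → Fin n → Bool
    adj X i j = does (adj? (X , i) (next X , j))

    e U : Part → ℤ
    e X = edges all all (adj X)
    U X = nonEdges all all (adj X)

    length-all : + length all ≡ N
    length-all = cong +_ (length-allFin n)

    e+U : ∀ X → e X + U X ≡ N * N
    e+U X = trans (edges+nonEdges all all (adj X)) (cong₂ _*_ length-all length-all)

    e≡ : ∀ X → N * N - U X ≡ e X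
    e≡ X = trans (cong (_- U X) (sym (e+U X))) (lem (e X) (U X))
      where
      lem : ∀ e u → e + u - u ≡ e
      lem = solve-∀

    U≡ : ∀ X → N * N - e X ≡ U X
    U≡ X = trans (cong (_- e X) (sym (e+U X))) (lem (e X) (U X))
      where
      lem : ∀ e u → e + u - e ≡ u
      lem = solve-∀

    e≥0 : ∀ X → 0ℤ ≤ e X
    e≥0 X = ∑∑-bit≥0 all all (adj X)

    U≥0 : ∀ X → 0ℤ ≤ U X
    U≥0 X = ∑∑-bit≥0 all all (λ i j → not (adj X i j))

    e≤N² : ∀ X → e X ≤ N * N
    e≤N² X = ≤-by (U X) (U≡ X) (U≥0 X)

    edgesBetween-count : ∀ X Y → + length (edgesBetween G X Y) ≡ edges all all (λ i j → does (adj? (X , i) (Y , j)))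
    edgesBetween-count X Y = trans (length-filter-∑ _ (cartesianProduct all all)) (∑-cartesianProduct all all _)

    edgesBetween-next : ∀ X → + length (edgesBetween G X (next X)) ≡ e X
    edgesBetween-next X = edgesBetween-count X (next X)

    edgesBetween-AC : + length (edgesBetween G A C) ≡ e C
    edgesBetween-AC = trans (edgesBetween-count A C) (trans (∑-swap all all _)
      (∑-cong all λ i → ∑-cong all λ j → ≤-antisym
        (bit-mono (adj? (A , j) (C , i)) (adj? (C , i) (A , j)) symmetric)
        (bit-mono (adj? (C , i) (A , j)) (adj? (A , j) (C , i)) symmetric)))

    -- e A, e B, e C count the edges of G[A,B], G[B,C] and G[C,A].
    cyclic : ∀ k .{{_ : ℕ.NonZero n}} →
      CyclicTriple k n (density G A B) (density G A C) (density G B C) →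
      Cyclic N (+ k - 1ℤ) (e A) (e B) (e C)
    cyclic k T = record
      { x≥0 = e≥0 A ; y≥0 = e≥0 B ; z≥0 = e≥0 C
      ; x≤n² = e≤N² A ; y≤n² = e≤N² B ; z≤n² = e≤N² C
      -- The cyclic order of parts lists the densities as AB, BC, CA, that is α, γ, β.
      ; xyz = above eAB eBC eAC αγ>1-β
      ; yxz = above eBC eAB eAC γα>1-β
      ; xzy = above eAB eAC eBC αβ>1-γ
      ; zxy = above eAC eAB eBC βα>1-γ
      ; yzx = above eBC eAC eAB γβ>1-α
      ; zyx = above eAC eBC eAB βγ>1-α }
      where
      open CyclicTriple T
      eAB : + length (edgesBetween G A B) ≡ e A
      eAB = edgesBetween-next A
      eBC : + length (edgesBetween G B C) ≡ e B
      eBC = edgesBetween-next B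
      eAC : + length (edgesBetween G A C) ≡ e C
      eAC = edgesBetween-AC
      above : ∀ {x y z x′ y′ z′} → x ≡ x′ → y ≡ y′ → z ≡ z′ →
        let _/n² : ℤ → ℚ.ℚ
            i /n² = (i ℚ./ (n ℕ.* n)) {{ℕ.m*n≢0 n n}}
        in x /n² ℚ.* (y /n² ℚ.- (+ k - 1ℤ) ℚ./ n) ℚ.+ z /n² ℚ.> ℚ.1ℚ → Above N (+ k - 1ℤ) x′ y′ z′
      above {x} {y} {z} refl refl refl gt = clear-denominators n (+ k - 1ℤ) x y z gt

    module _ (m : ℕ) (n-large : 5 ℕ.* m ℕ.+ 7 ℕ.≤ n) (S : Surplus N (+ m) (e A) (e B) (e C)) where

      N>0 : 0ℤ < N
      N>0 = +<+ (ℕ.≤-trans (s≤s z≤n) (ℕ.≤-trans (ℕ.m≤n+m 7 (5 ℕ.* m)) n-large))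

      surplus-at : ∀ X → Surplus N (+ m) (e X) (e (next X)) (e (next (next X)))
      surplus-at A = S
      surplus-at B = rotate S
      surplus-at C = rotate (rotate S)

      module _ {R : List (Vertex n)} {s : ℕ} (R+s : length R ℕ.+ s ≡ m) where

        outside? : ∀ X → Decidable (λ i → (X , i) ∉ R)
        outside? X i = ¬? ((X , i) ∈ⱽ? R)

        L : Part → List (Fin n)
        L X = filter (outside? X) all

        a : Part → ℤ
        a X = + length (filter (λ i → (X , i) ∈ⱽ? R) all)

        length-L : ∀ X → + length (L X) ≡ N - a X
        length-L X = trans (lem (+ length (L X)) (a X))
          (cong (_- a X) (trans (cong +_ (length-filter-¬ (λ i → (X , i) ∈ⱽ? R) all)) length-all))
          where
          lem : ∀ l a → l ≡ a + l - a
          lem = solve-∀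

        a≥0 : ∀ X → 0ℤ ≤ a X
        a≥0 X = 0≤pos

        a≤ : ∀ X → a X ≤ + length (fromPart X R)
        a≤ X = subst (_≤ + length (fromPart X R)) (sym (length-filter-∑ (λ i → (X , i) ∈ⱽ? R) all))
          (≤-trans (∑-mono all (λ {i} _ → bit-mono ((X , i) ∈ⱽ? R) (DecMembership._∈?_ Fin._≟_ i (fromPart X R)) (∈-fromPart R)))
                   (∑-∈ Fin._≟_ (Unique.allFin⁺ n) (fromPart X R)))

        total-a : a A + a B + a C ≤ + length R
        total-a = ≤-trans (+-mono-≤ (+-mono-≤ (a≤ A) (a≤ B)) (a≤ C)) (≤-reflexive (cong +_ (length-fromPart R)))

        budget : a A + a B + a C + + s ≤ + m
        budget = ≤-trans (+-monoˡ-≤ (+ s) total-a) (≤-reflexive (cong +_ R+s))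

        module _ {t : ℕ} (t≤s : t ℕ.≤ s) (P : Packing R t)
          (covered : ∀ X x → (X , x) ∉ R → ¬ ¬ Cover (Through R (X , x)) X (2 ℕ.* s))
          (maximum : ¬ Packing R (suc t)) where

          open Augment {s = s} P covered maximum

          module _ (classes : ∀ i → Strong i ⊎ Weak i) where
            open Deletion classes

            pair-≟ : DecidableEquality (Fin n × Fin n)
            pair-≟ = ≡-dec (Fin._≟_ {n}) (Fin._≟_ {n})

            _∈ᵈ?_ : ∀ (ij : Fin n × Fin n) D → Dec (ij ∈ D)
            _∈ᵈ?_ = DecMembership._∈?_ pair-≟

            cut kept : Part → Fin n → Fin n → Bool
            cut X i j = does ((i , j) ∈ᵈ? deleted X)
            kept X i j = adj X i j ∧ not (cut X i j)

            d : Part → ℤ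
            d X = + length (deleted X)

            nonEdges-kept : ∀ {X Y} → next X ≡ Y → nonEdges (L X) (L Y) (kept X) ≤ U X + d X
            nonEdges-kept {X} refl = ≤-trans (nonEdges-filter (outside? X) (outside? (next X)) all all (kept X))
              (≤-trans (nonEdges-∧ all all (adj X) (cut X))
                (+-monoʳ-≤ (U X) (subst (_≤ d X) (∑-cartesianProduct all all _)
                  (∑-∈ pair-≟ (Unique.cartesianProduct⁺ (Unique.allFin⁺ n) (Unique.allFin⁺ n)) (deleted X)))))

            I x : ℤ
            I = + length pairs
            x = + length extras

            -- The same index pairs are deleted between each two parts, hence the factor 3 on `I`,
            -- whereas the extra edges are distributed among the three pairs of parts.
            totals : + 3 * (+ 3 * I + x) ≤ + s * (+ 10 * + s + + 12) × I + x ≤ + s * (+ 2 * + s + + 4)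
            totals = deletion-total {t = + t} {σ = + length weaks} {κ = + length strongs} 0≤pos 0≤pos (+≤+ t≤s)
              (cong +_ strongs+weaks)
              (trans (cong +_ length-pairs) (cong₂ _+_ (pos-* (length weaks) t) (pos-* (length strongs) (length weaks))))
              (≤-trans (+≤+ length-extras) (≤-reflexive (cong₂ _+_ (pos-* (length weaks) 4)
                (trans (pos-* (length strongs) (2 ℕ.* s)) (cong (+ length strongs *_) (pos-* 2 s))))))

            d≡ : ∀ X → d X ≡ I + + length (fromPart X extras)
            d≡ X = cong +_ (length-deleted X)

            d-sum : + 3 * (d A + d B + d C) ≤ + s * (+ 10 * + s + + 12)
            d-sum = subst (_≤ + s * (+ 10 * + s + + 12))
              (cong (+ 3 *_) (sym (trans (cong₂ _+_ (cong₂ _+_ (d≡ A) (d≡ B)) (d≡ C))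
                (trans (lem I (+ length (fromPart A extras)) (+ length (fromPart B extras)) (+ length (fromPart C extras)))
                  (cong (λ z → + 3 * I + + z) (length-fromPart extras))))))
              (proj₁ totals)
              where
              lem : ∀ i a b c → i + a + (i + b) + (i + c) ≡ + 3 * i + (a + b + c)
              lem = solve-∀

            d-max : ∀ X → d X ≤ + s * (+ 2 * + s + + 4)
            d-max X = ≤-trans (subst (_≤ I + x) (sym (d≡ X)) (+-monoʳ-≤ I (+≤+ (part≤ X)))) (proj₂ totals)
              where
              part≤ : ∀ X → length (fromPart X extras) ℕ.≤ length extras
              part≤ A = subst (length (fromPart A extras) ℕ.≤_) (length-fromPart extras)
                (ℕ.≤-trans (ℕ.m≤m+n _ _) (ℕ.m≤m+n _ _))
              part≤ B = subst (length (fromPart B extras) ℕ.≤_) (length-fromPart extras)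
                (ℕ.≤-trans (ℕ.m≤n+m _ (length (fromPart A extras))) (ℕ.m≤m+n _ _))
              part≤ C = subst (length (fromPart C extras) ℕ.≤_) (length-fromPart extras) (ℕ.m≤n+m _ _)

            -- At the centre X the two incident pairs are coded by X and Z, and Y codes the opposite
            -- pair; hence the order of the deletion counts and the use of `slack-zx`.
            dense : ∀ {X Y Z} → next X ≡ Y → next Y ≡ Z → next Z ≡ X →
              a X + a Y + a Z + + s ≤ + m → + 3 * (d X + d Z + d Y) ≤ + s * (+ 10 * + s + + 12) →
              CentreDense (L X) (L Y) (L Z) (kept X) (kept Y) (kept Z)
            dense {X} {Y} {Z} refl refl Z→X aXYZ dXYZ =
              subst (λ l → l * l * nonEdges (L Y) (L Z) (kept Y) < edges (L X) (L Y) (kept X) * edges (L Z) (L X) (kept Z))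
                (sym (length-L X))
                (centre-after-deletion {N} {+ m} {a X} {a Y} {a Z} {+ s} {U X} {U Z} {U Y} {E} {d X} {d Z} {d Y}
                  {X = edges (L X) (L Y) (kept X)} {edges (L Z) (L X) (kept Z)}
                  N>0 (≤-trans (≤-reflexive (cong (_+ + 7) (sym (pos-* 5 m)))) (+≤+ n-large))
                  (a≥0 X) (a≥0 Y) (a≥0 Z) 0≤pos (U≥0 X) (U≥0 Z) 0≤pos 0≤pos 0≤pos aXYZ
                  (subst₂ _<_ (cong (λ z → N * N * z + + m * N * E) (U≡ Y))
                    (trans (*-comm (e Z) (e X)) (sym (cong₂ _*_ (e≡ X) (e≡ Z)))) slack-zx)
                  (subst (_≤ E) (sym (e≡ X)) x≤E) (subst (_≤ E) (sym (e≡ Z)) z≤E) large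
                  (subst (λ z → z + + m * N ≤ N * N) (trans (cong₂ _+_ (U≡ Z) (U≡ X)) (+-comm (U Z) (U X))) few-zx)
                  dXYZ (d-max Y)
                  (nonEdges-kept refl) (nonEdges-kept Z→X) (nonEdges-kept refl)
                  (trans (edges+nonEdges (L X) (L Y) (kept X)) (cong₂ _*_ (length-L X) (length-L Y)))
                  (trans (edges+nonEdges (L Z) (L X) (kept Z)) (trans (cong₂ _*_ (length-L Z) (length-L X)) (*-comm (N - a Z) (N - a X)))))
              where open Surplus (surplus-at X)

            -- What remains outside R after the deletions is dense at all three centres, yet
            -- triangle-free by `no-survivor`.
            classified-impossible : ⊥
            classified-impossible = three-centres (L A) (L B) (L C) (kept A) (kept B) (kept C)
              (dense {A} refl refl refl budget (subst small (swap (d A) (d B) (d C)) d-sum))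
              (dense {B} refl refl refl (subst (_≤ + m) (cong (_+ + s) (cycle (a A) (a B) (a C))) budget)
                (subst small (trans (cycle (d A) (d B) (d C)) (swap (d B) (d C) (d A))) d-sum))
              (dense {C} refl refl refl (subst (_≤ + m) (cong (_+ + s) (sym (cycle (a C) (a A) (a B)))) budget)
                (subst small (trans (sym (cycle (d C) (d A) (d B))) (swap (d C) (d A) (d B))) d-sum))
              triangle-free
              where
              small : ℤ → Set
              small z = + 3 * z ≤ + s * (+ 10 * + s + + 12)
              swap : ∀ a b c → a + b + c ≡ a + c + b
              swap = solve-∀
              cycle : ∀ a b c → a + b + c ≡ b + c + a
              cycle = solve-∀
              ∧-true : ∀ {a b} → a ∧ not b ≡ true → a ≡ true × b ≡ false
              ∧-true {true} {false} _ = refl , refl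
              holds : ∀ {Q : Set} (Q? : Dec Q) → does Q? ≡ true → Q
              holds (yes q) _ = q
              fails : ∀ {Q : Set} (Q? : Dec Q) → does Q? ≡ false → ¬ Q
              fails (no ¬q) _ = ¬q
              adjacent : ∀ X {i j} → kept X i j ≡ true → Adj (X , i) (next X , j)
              adjacent X {i} {j} k = holds (adj? (X , i) (next X , j)) (proj₁ (∧-true k))
              uncut : ∀ X {i j} → kept X i j ≡ true → (i , j) ∉ deleted X
              uncut X {i} {j} k = fails ((i , j) ∈ᵈ? deleted X) (proj₂ (∧-true {adj X i j} k))
              triangle-free : TriangleFree (L A) (L B) (L C) (kept A) (kept B) (kept C)
              triangle-free {i} {j} {k} i∈ j∈ k∈ ij jk ki = Survivor.no-survivor τ τ-tri τ-avoids τ-survives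
                where
                τ : Triple n
                τ A = i
                τ B = j
                τ C = k
                kept-τ : ∀ X → kept X (τ X) (τ (next X)) ≡ true
                kept-τ A = ij
                kept-τ B = jk
                kept-τ C = ki
                τ-tri : Tri τ
                τ-tri {X} {Y} X≢Y with others (≢-sym X≢Y)
                ... | inj₁ refl = adjacent X (kept-τ X)
                ... | inj₂ refl = symmetric (subst (λ Z → Adj (prev X , τ (prev X)) (Z , τ Z)) (next-prev X)
                                    (adjacent (prev X) (kept-τ (prev X))))
                τ-avoids : Avoids R τ
                τ-avoids A = proj₂ (∈-filter⁻ (outside? A) {xs = all} i∈)
                τ-avoids B = proj₂ (∈-filter⁻ (outside? B) {xs = all} j∈)
                τ-avoids C = proj₂ (∈-filter⁻ (outside? C) {xs = all} k∈)
                τ-survives : ∀ X → (τ X , τ (next X)) ∉ deleted X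
                τ-survives X = uncut X (kept-τ X)

          not-maximum : ⊥
          not-maximum = ¬¬-finite-choice classify classified-impossible

        -- With no robust vertex left outside `R`, a packing of at most s triangles is never
        -- maximum, so induction on t reaches s + 1.
        grow : (∀ X x → (X , x) ∉ R → ¬ ¬ Cover (Through R (X , x)) X (2 ℕ.* s)) →
          ∀ t → t ℕ.≤ ℕ.suc s → ¬ ¬ Packing R t
        grow covered zero    _         k = k empty
        grow covered (suc t) (s≤s t≤s) k =
          grow covered t (ℕ.m≤n⇒m≤1+n t≤s) λ P → not-maximum t≤s P covered k

      -- A vertex robust against 2 s forbidden vertices is set aside: it can be added back to any
      -- s triangles avoiding it.
      reserve : ∀ s R → length R ℕ.+ s ≡ m → ¬ ¬ Packing R (ℕ.suc s)
      reserve s R R+s = decide (∃[ X ] ∃[ x ] (X , x) ∉ R × ¬ Cover (Through R (X , x)) X (2 ℕ.* s))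
        (λ (X , x , _ , uncovered) k → reserved s R+s λ P → add-robust P (robust uncovered) k)
        (λ none → grow R+s (λ X x v∉R uncovered → none (X , x , v∉R , uncovered)) (ℕ.suc s) ℕ.≤-refl)
        where
        -- Setting v aside uses one unit of s and one of the s + 1 triangles. For s = 0 the triangle
        -- through v is the only one wanted, so the empty packing will do.
        reserved : ∀ {v} s → length R ℕ.+ s ≡ m → ¬ ¬ Packing (v ∷ R) s
        reserved zero    _  k = k empty
        reserved {v} (suc s) eq = reserve s (v ∷ R) (trans (sym (ℕ.+-suc (length R) s)) eq)

    -- Stated for vectors of indices, so that all candidates can be searched and the double negation
    -- removed.
    Disjoint : ∀ {k} → Vec (Fin n) k → Vec (Fin n) k → Vec (Fin n) k → Set
    Disjoint as bs cs =
      (∀ i → Adj (A , lookup as i) (B , lookup bs i) × Adj (A , lookup as i) (C , lookup cs i)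
             × Adj (B , lookup bs i) (C , lookup cs i))
      × (∀ i j → i ≡ j ⊎ (lookup as i ≢ lookup as j × lookup bs i ≢ lookup bs j × lookup cs i ≢ lookup cs j))

    disjoint? : ∀ {k} (as bs cs : Vec (Fin n) k) → Dec (Disjoint as bs cs)
    disjoint? as bs cs =
      Fin.all? (λ i → adj? _ _ ×-dec adj? _ _ ×-dec adj? _ _)
      ×-dec Fin.all? (λ i → Fin.all? λ j → i Fin.≟ j ⊎-dec
              (¬? (lookup as i Fin.≟ lookup as j) ×-dec ¬? (lookup bs i Fin.≟ lookup bs j)
               ×-dec ¬? (lookup cs i Fin.≟ lookup cs j)))

    any-vec? : ∀ {k} {Q : Vec (Fin n) k → Set} → Decidable Q → Dec (∃ Q)
    any-vec? {zero}  Q? = map′ ([] ,_) (λ { ([] , q) → q }) (Q? [])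
    any-vec? {suc k} Q? = map′ (λ (x , xs , q) → x ∷ xs , q) (λ { (x ∷ xs , q) → x , xs , q })
      (Fin.any? λ x → any-vec? λ xs → Q? (x ∷ xs))

    packing⇒vecs : ∀ {k} → Packing [] k → ∃[ as ] ∃[ bs ] ∃[ cs ] Disjoint {k} as bs cs
    packing⇒vecs {k} P = vec A , vec B , vec C ,
      (λ i → at i (λ ()) , at i (λ ()) , at i (λ ())) ,
      λ i j → case i Fin.≟ j of λ where
        (yes i≡j) → inj₁ i≡j
        (no i≢j)  → inj₂ (apart A i≢j , apart B i≢j , apart C i≢j)
      where
      open Packing P
      vec : Part → Vec (Fin n) k
      vec X = tabulate (λ i → T i X)
      at : ∀ i {X Y} → X ≢ Y → Adj (X , lookup (vec X) i) (Y , lookup (vec Y) i)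
      at i {X} {Y} X≢Y = subst₂ (λ x y → Adj (X , x) (Y , y)) (sym (lookup∘tabulate _ i)) (sym (lookup∘tabulate _ i)) (tri i X≢Y)
      apart : ∀ X {i j} → i ≢ j → lookup (vec X) i ≢ lookup (vec X) j
      apart X {i} {j} i≢j eq = disjoint i≢j X
        (trans (sym (lookup∘tabulate _ i)) (trans eq (lookup∘tabulate _ j)))

    vecs⇒triangles : ∀ {k} → (∃[ as ] ∃[ bs ] ∃[ cs ] Disjoint {k} as bs cs) → HasDisjointTriangles G k
    vecs⇒triangles {k} (as , bs , cs , adjacent , apart) = T , disj
      where
      T : Fin k → Triangle G
      T i = record { x = A , lookup as i ; y = B , lookup bs i ; z = C , lookup cs i
                   ; xy = proj₁ (adjacent i) ; xz = proj₁ (proj₂ (adjacent i)) ; yz = proj₂ (proj₂ (adjacent i)) }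
      disj : ∀ {i j} → i ≢ j → VertexDisjoint G (T i) (T j)
      disj {i} {j} i≢j (∈i , ∈j) with apart i j
      ... | inj₁ i≡j = i≢j i≡j
      ... | inj₂ (a≢ , b≢ , c≢) = clash ∈i ∈j
        where
        clash : ∀ {v} → v ∈ Triangle.vertices (T i) → v ∈ Triangle.vertices (T j) → ⊥
        clash (here refl)                 (here eq)                 = a≢ (cong proj₂ eq)
        clash (here refl)                 (there (there (here ())))
        clash (there (here refl))         (there (here eq))         = b≢ (cong proj₂ eq)
        clash (there (here refl))         (there (there (here ())))
        clash (there (there (here refl))) (there (there (here eq))) = c≢ (cong proj₂ eq)

    disjoint-triangles : ∀ m .{{_ : ℕ.NonZero n}} → n ℕ.≥ 5 ℕ.* suc m ℕ.+ 2 →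
      CyclicTriple (suc m) n (density G A B) (density G A C) (density G B C) → HasDisjointTriangles G (suc m)
    disjoint-triangles m n≥5k+2 cyclicTriple = vecs⇒triangles
      (decidable-stable (any-vec? λ as → any-vec? λ bs → any-vec? λ cs → disjoint? as bs cs)
        -- Nothing is set aside at first, so the whole budget s = m = k - 1 is available and k
        -- triangles result.
        λ none → reserve m n≥5m+7 S m [] refl (none ∘ packing⇒vecs))
      where
      n≥5m+7 : 5 ℕ.* m ℕ.+ 7 ℕ.≤ n
      n≥5m+7 = ℕ.≤-trans (ℕ.≤-reflexive (trans (sym (ℕ.+-assoc (5 ℕ.* m) 5 2))
        (cong (ℕ._+ 2) (trans (ℕ.+-comm (5 ℕ.* m) 5) (sym (ℕ.*-suc 5 m)))))) n≥5k+2
      S : Surplus N (+ m) (e A) (e B) (e C)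
      S = surplus (+<+ (ℕ.≤-trans (s≤s z≤n) (ℕ.≤-trans (ℕ.m≤n+m 7 (5 ℕ.* m)) n≥5m+7))) 0≤pos
        (cyclic (suc m) cyclicTriple)

open import Defs
open import Data.Nat using (ℕ; suc; NonZero; _+_; _*_; _≥_)

theorem1p3 : (n k : ℕ) .{{_ : NonZero n}} → k ≥ 2 → n ≥ 5 * k + 2 →
    (G : TripartiteGraph n) →
    CyclicTriple k n (density G A B) (density G A C) (density G B C) →
    HasDisjointTriangles G k
theorem1p3 n (suc m) _ n≥5k+2 G cyclicTriple = Counting.Glue.disjoint-triangles G m n≥5k+2 cyclicTriple
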